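{- Every valid sequent of $\text{HXPath}_{\rm D}$ is provable in the sequent calculus $\mathbf{G}$: if $\Gamma\vdash\Delta$ is a sequent such that for every model $\mathcal{M}$, $\mathcal{M}\Vdash\gamma$ for all $\gamma\in\Gamma$ implies $\mathcal{M}\Vdash\delta$ for some $\delta\in\Delta$, then $\Gamma\vdash_{\mathbf{G}}\Delta$.
   Context: Fix pairwise disjoint sets $\mathsf{Prop}$ (countably infinite; propositional symbols $p$), $\mathsf{Nom}$ (countably infinite; nominals $i,j,k,\dots$), $\mathsf{Mod}$ (finite; modalities $\mathsf{a}$) and $\mathsf{Cmp}$ (finite; comparison symbols $\mathsf{c}$). Path expressions $\alpha,\beta$ and node expressions $\varphi,\psi$ are defined by mutual recursion: $\alpha,\beta ::= \mathsf{a} \mid i{:} \mid \varphi? \mid \alpha\beta$ and $\varphi,\psi ::= p \mid i \mid \bot \mid \varphi\to\psi \mid @_i\varphi \mid \langle \mathsf{a}\rangle\varphi \mid \langle \alpha =_{\mathsf{c}} \beta\rangle \mid \langle \alpha \neq_{\mathsf{c}} \beta\rangle$. Abbreviations: $\top:=\bot\to\bot$, $\neg\varphi:=\varphi\to\bot$, $\varphi\wedge\psi:=\neg(\varphi\to\neg\psi)$, and for arbitrary paths $\langle j{:}\rangle\varphi:=@_j\varphi$, $\langle\psi?\rangle\varphi:=\psi\wedge\varphi$, $\langle\alpha\beta\rangle\varphi:=\langle\alpha\rangle\langle\beta\rangle\varphi$. The symbol $\blacktriangle$ stands for either $=_{\mathsf{c}}$ or $\neq_{\mathsf{c}}$ (for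 some $\mathsf{c}\in\mathsf{Cmp}$). A model is $\mathcal{M}=(N,\{R_{\mathsf{a}}\}_{\mathsf{a}\in\mathsf{Mod}},\{\approx_{\mathsf{c}}\}_{\mathsf{c}\in\mathsf{Cmp}},g,V)$ with $N\neq\emptyset$, each $R_{\mathsf{a}}\subseteq N\times N$, each $\approx_{\mathsf{c}}$ an equivalence relation on $N$, $g:\mathsf{Nom}\to N$, $V:\mathsf{Prop}\to 2^N$. Semantics: $\mathcal{M},n,n'\Vdash\mathsf{a}$ iff $nR_{\mathsf{a}}n'$; $\mathcal{M},n,n'\Vdash i{:}$ iff $g(i)=n'$; $\mathcal{M},n,n'\Vdash\varphi?$ iff $n=n'$ and $\mathcal{M},n\Vdash\varphi$; $\mathcal{M},n,n'\Vdash\alpha\beta$ iff there is $n''$ with $\mathcal{M},n,n''\Vdash\alpha$ and $\mathcal{M},n'',n'\Vdash\beta$; $\mathcal{M},n\Vdash p$ iff $n\in V(p)$; $\mathcal{M},n\Vdash i$ iff $g(i)=n$; $\bot$ is never true; $\to$ is classical; $\mathcal{M},n\Vdash @_i\varphi$ iff $\mathcal{M},g(i)\Vdash\varphi$; $\mathcal{M},n\Vdash\langle\mathsf{a}\rangle\varphi$ iff some $n'$ has $nR_{\mathsf{a}}n'$ and $\mathcal{M},n'\Vdash\varphi$; $\mathcal{M},n\Vdash\langle\alpha=_{\mathsf{c}}\beta\rangle$ (resp. $\langle\alpha\neq_{\mathsf{c}}\beta\rangle$) iff there are $n',n''$ with $\mathcal{M},n,n'\Vdash\alpha$, $\mathcal{M},n,n''\Vdash\beta$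 and $n'\approx_{\mathsf{c}}n''$ (resp. $n'\not\approx_{\mathsf{c}}n''$). A sequent is a pair $\Gamma\vdash\Delta$ of finite (possibly empty) sets of node expressions, each of the form $\langle i{:}\blacktriangle j{:}\rangle$ or $@_i\varphi$; the truth of such expressions does not depend on the evaluation node, and we write $\mathcal{M}\Vdash\chi$. Commas denote union; "from $P_1;\dots;P_n$ infer $C$" denotes a rule with premisses $P_i$ and conclusion $C$; $\Gamma,\Delta,\Gamma',\Delta'$ are arbitrary. Rules of $\mathbf{G}$. Propositional: (Ax) $\varphi,\Gamma\vdash\Delta,\varphi$ where $\varphi$ is of the form $@_ip$, $@_ij$ or $\langle i{:}=_{\mathsf{c}}j{:}\rangle$; ($\bot$) $@_i\bot,\Gamma\vdash\Delta$; ($\to$L) from $\Gamma\vdash\Delta,@_i\varphi$; $@_i\psi,\Gamma\vdash\Delta$ infer $@_i(\varphi\to\psi),\Gamma\vdash\Delta$; ($\to$R) from $@_i\varphi,\Gamma\vdash\Delta,@_i\psi$ infer $\Gamma\vdash\Delta,@_i(\varphi\to\psi)$. Nominals: ($@$T) from $@_ii,\Gamma\vdash\Delta$ infer $\Gamma\vdash\Delta$; ($@5$) from $@_jk,@_ij,@_ik,\Gamma\vdash\Delta$ infer $@_ij,@_ik,\Gamma\vdash\Delta$; (Nom) from $@_ij,\Gamma\vdash\Delta$ infer $\Gamma\vdash\Delta$, where $j$ does not occur in the conclusion; (S$_1$) from $@_j\varphi,@_ij,@_i\varphi,\Gamma\vdash\Delta$ infer $@_ij,@_i\varphi,\Gamma\vdash\Delta$,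 where $\varphi$ is $p$, $\bot$ or $\langle\mathsf{a}\rangle k$; (S$_2$) from $@_i\langle\mathsf{a}\rangle k,@_jk,@_i\langle\mathsf{a}\rangle j,\Gamma\vdash\Delta$ infer $@_jk,@_i\langle\mathsf{a}\rangle j,\Gamma\vdash\Delta$; (S$_3$) from $\langle j{:}=_{\mathsf{c}}k{:}\rangle,@_ij,\langle i{:}=_{\mathsf{c}}k{:}\rangle,\Gamma\vdash\Delta$ infer $@_ij,\langle i{:}=_{\mathsf{c}}k{:}\rangle,\Gamma\vdash\Delta$. Modalities: ($@$L) from $@_i\varphi,\Gamma\vdash\Delta$ infer $@_j@_i\varphi,\Gamma\vdash\Delta$; ($@$R) from $\Gamma\vdash\Delta,@_i\varphi$ infer $\Gamma\vdash\Delta,@_j@_i\varphi$; ($\langle\mathsf{a}\rangle$L) from $@_i\langle\mathsf{a}\rangle j,@_j\varphi,\Gamma\vdash\Delta$ infer $@_i\langle\mathsf{a}\rangle\varphi,\Gamma\vdash\Delta$, where $j$ does not occur in the conclusion; ($\langle\mathsf{a}\rangle$R) from $@_i\langle\mathsf{a}\rangle j,\Gamma\vdash\Delta,@_i\langle\mathsf{a}\rangle\varphi,@_j\varphi$ infer $@_i\langle\mathsf{a}\rangle j,\Gamma\vdash\Delta,@_i\langle\mathsf{a}\rangle\varphi$; ($\langle\blacktriangle\rangle$L) from $@_i\langle\alpha\rangle j,@_i\langle\beta\rangle k,\langle j{:}\blacktriangle k{:}\rangle,\Gamma\vdash\Delta$ infer $@_i\langle\alpha\blacktriangle\beta\rangle,\Gamma\vdash\Delta$,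 where $j,k$ are distinct and do not occur in the conclusion; ($\langle\blacktriangle\rangle$R) from $@_i\langle\alpha\rangle j,@_i\langle\beta\rangle k,\Gamma\vdash\Delta,@_i\langle\alpha\blacktriangle\beta\rangle,\langle j{:}\blacktriangle k{:}\rangle$ infer $@_i\langle\alpha\rangle j,@_i\langle\beta\rangle k,\Gamma\vdash\Delta,@_i\langle\alpha\blacktriangle\beta\rangle$. Data comparison: (EqT) from $\langle i{:}=_{\mathsf{c}}i{:}\rangle,\Gamma\vdash\Delta$ infer $\Gamma\vdash\Delta$; (Eq5) from $\langle j{:}=_{\mathsf{c}}k{:}\rangle,\langle i{:}=_{\mathsf{c}}j{:}\rangle,\langle i{:}=_{\mathsf{c}}k{:}\rangle,\Gamma\vdash\Delta$ infer $\langle i{:}=_{\mathsf{c}}j{:}\rangle,\langle i{:}=_{\mathsf{c}}k{:}\rangle,\Gamma\vdash\Delta$; (NEqL) from $\Gamma\vdash\Delta,\langle i{:}=_{\mathsf{c}}j{:}\rangle$ infer $\langle i{:}\neq_{\mathsf{c}}j{:}\rangle,\Gamma\vdash\Delta$; (NEqR) from $\langle i{:}=_{\mathsf{c}}j{:}\rangle,\Gamma\vdash\Delta$ infer $\Gamma\vdash\Delta,\langle i{:}\neq_{\mathsf{c}}j{:}\rangle$. Structural: (Cut) from $\Gamma\vdash\Delta,\varphi$; $\varphi,\Gamma'\vdash\Delta'$ infer $\Gamma,\Gamma'\vdash\Delta,\Delta'$; (WL) from $\Gamma\vdash\Delta$ infer $\varphi,\Gamma\vdash\Delta$; (WR) from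 $\Gamma\vdash\Delta$ infer $\Gamma\vdash\Delta,\varphi$. A derivation is a finite tree labelled by sequents in which each non-leaf node is the conclusion of an instance of a rule of $\mathbf{G}$ whose premisses are exactly its children; the root is the end-sequent. $\Gamma\vdash\Delta$ is provable, written $\Gamma\vdash_{\mathbf{G}}\Delta$, if it is the end-sequent of a derivation all of whose leaves are instances of (Ax) or ($\bot$). -}

module Defs where

open import Data.Nat using (ℕ)
open import Data.Fin using (Fin)
open import Data.Empty using (⊥)
open import Data.Product using (Σ; _×_)
open import Data.Sum using (_⊎_)
open import Data.List using (List; []; _∷_; _++_)
open import Data.List.Relation.Unary.All using (All)
open import Data.List.Relation.Unary.Any using (Any)
open import Data.List.Relation.Binary.Subset.Propositional using (_⊆_)
open import Relation.Binary.PropositionalEquality using (_≡_; _≢_)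
open import Relation.Binary.Structures using (IsEquivalence)
open import Relation.Nullary using (¬_)

data Pol : Set where
  eqP neqP : Pol

module HX (nm nc : ℕ) where

  Mod : Set
  Mod = Fin nm

  Cmp : Set
  Cmp = Fin nc

  Prop : Set
  Prop = ℕ

  Nom : Set
  Nom = ℕ

  mutual
    data Path : Set where
      mod  : Mod → Path
      nomP : Nom → Path
      test : Form → Path
      seq  : Path → Path → Path

    data Form : Set where
      prop : Prop → Form
      nom  : Nom → Form
      ⊥'   : Form
      _⇒_  : Form → Form → Form
      at   : Nom → Form → Form
      dia  : Mod → Form → Form
      cmp  : Path → Pol → Cmp → Path → Form

  infixr 5 _⇒_

  ¬' : Form → Form
  ¬' φ = φ ⇒ ⊥'

  _∧'_ : Form → Form → Form
  φ ∧' ψ = ¬' (φ ⇒ ¬' ψ)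

  diaP : Path → Form → Form
  diaP (mod a) φ = dia a φ
  diaP (nomP j) φ = at j φ
  diaP (test ψ) φ = ψ ∧' φ
  diaP (seq α β) φ = diaP α (diaP β φ)

  data SF : Set where
    atS  : Nom → Form → SF
    cmpS : Nom → Pol → Cmp → Nom → SF

  ⌜_⌝ : SF → Form
  ⌜ atS i φ ⌝ = at i φ
  ⌜ cmpS i s c j ⌝ = cmp (nomP i) s c (nomP j)

  EQ : Nom → Cmp → Nom → SF
  EQ i c j = cmpS i eqP c j

  NEQ : Nom → Cmp → Nom → SF
  NEQ i c j = cmpS i neqP c j

  mutual
    OccP : Nom → Path → Set
    OccP j (mod a) = ⊥
    OccP j (nomP i) = i ≡ j
    OccP j (test φ) = OccF j φ
    OccP j (seq α β) = OccP j α ⊎ OccP j β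

    OccF : Nom → Form → Set
    OccF j (prop p) = ⊥
    OccF j (nom i) = i ≡ j
    OccF j ⊥' = ⊥
    OccF j (φ ⇒ ψ) = OccF j φ ⊎ OccF j ψ
    OccF j (at i φ) = i ≡ j ⊎ OccF j φ
    OccF j (dia a φ) = OccF j φ
    OccF j (cmp α s c β) = OccP j α ⊎ OccP j β

  OccL : Nom → List SF → Set
  OccL j Γ = Any (λ χ → OccF j ⌜ χ ⌝) Γ

  Fresh : Nom → List SF → List SF → Set
  Fresh j Γ Δ = ¬ OccL j Γ × ¬ OccL j Δ

  -- finite sets represented by lists, compared extensionally
  _≋_ : List SF → List SF → Set
  Γ ≋ Γ' = (Γ ⊆ Γ') × (Γ' ⊆ Γ)

  data AxForm : SF → Set where
    axP : ∀ {i p} → AxForm (atS i (prop p))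
    axN : ∀ {i j} → AxForm (atS i (nom j))
    axE : ∀ {i c j} → AxForm (EQ i c j)

  data S1Form : Form → Set where
    s1p : ∀ {p} → S1Form (prop p)
    s1b : S1Form ⊥'
    s1d : ∀ {a k} → S1Form (dia a (nom k))

  infix 4 _⊢G_

  -- Derivability in G.  "φ ∷ Γ" stands for "φ, Γ" and "φ ∷ Δ" for "Δ, φ";
  -- sequents are sets, so the rule `reorder` identifies list
  -- representatives with the same elements.
  data _⊢G_ : List SF → List SF → Set where
    ax   : ∀ {φ Γ Δ} → AxForm φ → (φ ∷ Γ) ⊢G (φ ∷ Δ)
    bot  : ∀ {i Γ Δ} → (atS i ⊥' ∷ Γ) ⊢G Δ
    impL : ∀ {i φ ψ Γ Δ} → Γ ⊢G (atS i φ ∷ Δ) → (atS i ψ ∷ Γ) ⊢G Δ →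
           (atS i (φ ⇒ ψ) ∷ Γ) ⊢G Δ
    impR : ∀ {i φ ψ Γ Δ} → (atS i φ ∷ Γ) ⊢G (atS i ψ ∷ Δ) →
           Γ ⊢G (atS i (φ ⇒ ψ) ∷ Δ)
    atT  : ∀ {i Γ Δ} → (atS i (nom i) ∷ Γ) ⊢G Δ → Γ ⊢G Δ
    at5  : ∀ {i j k Γ Δ} →
           (atS j (nom k) ∷ atS i (nom j) ∷ atS i (nom k) ∷ Γ) ⊢G Δ →
           (atS i (nom j) ∷ atS i (nom k) ∷ Γ) ⊢G Δ
    nomR : ∀ {i j Γ Δ} → Fresh j Γ Δ → (atS i (nom j) ∷ Γ) ⊢G Δ → Γ ⊢G Δ
    S₁   : ∀ {i j φ Γ Δ} → S1Form φ →
           (atS j φ ∷ atS i (nom j) ∷ atS i φ ∷ Γ) ⊢G Δ →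
           (atS i (nom j) ∷ atS i φ ∷ Γ) ⊢G Δ
    S₂   : ∀ {i j k a Γ Δ} →
           (atS i (dia a (nom k)) ∷ atS j (nom k) ∷ atS i (dia a (nom j)) ∷ Γ) ⊢G Δ →
           (atS j (nom k) ∷ atS i (dia a (nom j)) ∷ Γ) ⊢G Δ
    S₃   : ∀ {i j k c Γ Δ} →
           (EQ j c k ∷ atS i (nom j) ∷ EQ i c k ∷ Γ) ⊢G Δ →
           (atS i (nom j) ∷ EQ i c k ∷ Γ) ⊢G Δ
    atL  : ∀ {i j φ Γ Δ} → (atS i φ ∷ Γ) ⊢G Δ → (atS j (at i φ) ∷ Γ) ⊢G Δ
    atR  : ∀ {i j φ Γ Δ} → Γ ⊢G (atS i φ ∷ Δ) → Γ ⊢G (atS j (at i φ) ∷ Δ)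
    diaL : ∀ {i j a φ Γ Δ} → Fresh j (atS i (dia a φ) ∷ Γ) Δ →
           (atS i (dia a (nom j)) ∷ atS j φ ∷ Γ) ⊢G Δ →
           (atS i (dia a φ) ∷ Γ) ⊢G Δ
    diaR : ∀ {i j a φ Γ Δ} →
           (atS i (dia a (nom j)) ∷ Γ) ⊢G (atS i (dia a φ) ∷ atS j φ ∷ Δ) →
           (atS i (dia a (nom j)) ∷ Γ) ⊢G (atS i (dia a φ) ∷ Δ)
    cmpL : ∀ {i j k α β s c Γ Δ} → j ≢ k →
           Fresh j (atS i (cmp α s c β) ∷ Γ) Δ →
           Fresh k (atS i (cmp α s c β) ∷ Γ) Δ →
           (atS i (diaP α (nom j)) ∷ atS i (diaP β (nom k)) ∷ cmpS j s c k ∷ Γ) ⊢G Δ →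
           (atS i (cmp α s c β) ∷ Γ) ⊢G Δ
    cmpR : ∀ {i j k α β s c Γ Δ} →
           (atS i (diaP α (nom j)) ∷ atS i (diaP β (nom k)) ∷ Γ)
             ⊢G (atS i (cmp α s c β) ∷ cmpS j s c k ∷ Δ) →
           (atS i (diaP α (nom j)) ∷ atS i (diaP β (nom k)) ∷ Γ)
             ⊢G (atS i (cmp α s c β) ∷ Δ)
    eqT  : ∀ {i c Γ Δ} → (EQ i c i ∷ Γ) ⊢G Δ → Γ ⊢G Δ
    eq5  : ∀ {i j k c Γ Δ} →
           (EQ j c k ∷ EQ i c j ∷ EQ i c k ∷ Γ) ⊢G Δ →
           (EQ i c j ∷ EQ i c k ∷ Γ) ⊢G Δ
    neqL : ∀ {i j c Γ Δ} → Γ ⊢G (EQ i c j ∷ Δ) → (NEQ i c j ∷ Γ) ⊢G Δ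
    neqR : ∀ {i j c Γ Δ} → (EQ i c j ∷ Γ) ⊢G Δ → Γ ⊢G (NEQ i c j ∷ Δ)
    cut  : ∀ {φ Γ Δ Γ' Δ'} → Γ ⊢G (φ ∷ Δ) → (φ ∷ Γ') ⊢G Δ' →
           (Γ ++ Γ') ⊢G (Δ ++ Δ')
    wL   : ∀ {φ Γ Δ} → Γ ⊢G Δ → (φ ∷ Γ) ⊢G Δ
    wR   : ∀ {φ Γ Δ} → Γ ⊢G Δ → Γ ⊢G (φ ∷ Δ)
    reorder : ∀ {Γ Δ Γ' Δ'} → Γ ≋ Γ' → Δ ≋ Δ' → Γ ⊢G Δ → Γ' ⊢G Δ'

  record Model : Set₁ where
    field
      N     : Set
      point : N
      R     : Mod → N → N → Set
      E     : Cmp → N → N → Set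
      E-eq  : (c : Cmp) → IsEquivalence (E c)
      g     : Nom → N
      V     : Prop → N → Set

  module _ (M : Model) where
    open Model M

    mutual
      PSat : Path → N → N → Set
      PSat (mod a) n n' = R a n n'
      PSat (nomP i) n n' = g i ≡ n'
      PSat (test φ) n n' = (n ≡ n') × Sat n φ
      PSat (seq α β) n n' = Σ N (λ m → PSat α n m × PSat β m n')

      Sat : N → Form → Set
      Sat n (prop p) = V p n
      Sat n (nom i) = g i ≡ n
      Sat n ⊥' = ⊥
      Sat n (φ ⇒ ψ) = Sat n φ → Sat n ψ
      Sat n (at i φ) = Sat (g i) φ
      Sat n (dia a φ) = Σ N (λ n' → R a n n' × Sat n' φ)
      Sat n (cmp α eqP c β) =
        Σ N (λ n' → Σ N (λ n'' → PSat α n n' × PSat β n n'' × E c n' n''))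
      Sat n (cmp α neqP c β) =
        Σ N (λ n' → Σ N (λ n'' → PSat α n n' × PSat β n n'' × ¬ E c n' n''))

    -- M ⊩ χ for a sequent formula (node-independent; we require it at all nodes)
    Holds : SF → Set
    Holds χ = (n : N) → Sat n ⌜ χ ⌝

  Valid : List SF → List SF → Set₁
  Valid Γ Δ = (M : Model) → All (Holds M) Γ → Any (Holds M) Δ

{-# OPTIONS --safe #-}

-- Provability is stable under double negation if the theorem holds, so a
-- decision procedure is unavoidable: a tableau either closes, which gives a
-- derivation, or has an open branch, which gives a countermodel.
--
-- The nominals of the sequent are named points; all other points form trees
-- below them, of depth bounded by the modal depth of the sequent.  Inside a tree
-- every true diamond or comparison is expanded with fresh nominals, but a path
-- that meets a named point s with steps σs left is not followed any further:
-- one only records that σs leads from s into the data class of its endpoint j.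
-- The type of a class consists of all such records (s , σs) and of the named
-- classes it equals.  There are finitely many types, and the paths (s , σs) are
-- expanded for a single class of each type; this bounds the tableau, whereas
-- expanding them for all classes could go on for ever.
--
-- The countermodel consists of the named points and of ℤ-many copies of the
-- forest.  A data class of the model is a type with an integer colour: in the
-- k-th copy the class of x has the representative of x, shifted by k, as its
-- colour, so distinct classes of one copy stay distinct and every class of
-- a given type occurs, in a suitable copy, at the end of the expanded paths.
-- Classes of nominals that were present before the expansion of types began are
-- shared by all copies; among them is a witness for every path (s , σs) that has
-- an endpoint, which takes care of paths all of whose endpoints are equivalent.
module Submission where

open import Defs
open import Data.Nat using (ℕ; zero; suc; _+_; _⊔_; _≤_; _<_; z≤n; s≤s; _≤?_; s≤s⁻¹)
import Data.Nat.Properties as ℕ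
open import Data.Empty using (⊥; ⊥-elim)
open import Data.Product using (∃; ∃-syntax; _×_; _,_; proj₁; proj₂)
open import Data.Sum using (_⊎_; inj₁; inj₂; [_,_]′)
open import Data.List using (List; []; _∷_; _++_; length; map; concatMap; allFin; upTo
  ; cartesianProductWith; tails)
open import Data.List.Relation.Unary.Any using (here; there)
open import Data.List.Membership.Propositional using (_∈_; lose; find)
open import Data.List.Membership.Propositional.Properties using (∈-++⁻; ∈-++⁺ʳ; ∈-++⁺ˡ; ∈-map⁺
  ; ∈-allFin; ∈-concatMap⁺; ∈-map⁻; ∈-upTo⁺; ∈-upTo⁻; ∈-cartesianProductWith⁺
  ; ∈-cartesianProductWith⁻; ∈-concatMap⁻)
open import Data.List.Relation.Binary.Subset.Propositional using (_⊆_)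
open import Relation.Binary.PropositionalEquality using (_≡_; _≢_; refl; sym; trans; cong; cong₂
  ; subst)
open import Relation.Nullary using (¬_; yes; no; Dec; does)
open import Function using (id; _∘_)
open import Data.Bool using (Bool; true; false; if_then_else_)
import Data.Fin.Properties as Fin
open import Data.Unit using (⊤; tt)
import Data.Sum as Sum
import Data.Sum.Properties as Sum
open import Data.List.Properties using (∷-injectiveˡ; ∷-injectiveʳ)
open import Data.List.Relation.Binary.Pointwise using (Pointwise; []; _∷_)
open import Relation.Binary.Definitions using (DecidableEquality)
open import Relation.Nullary.Decidable using (map′)
import Data.List.Relation.Binary.Pointwise as Pointwise
import Data.List.Membership.DecPropositional as DecMembership
open import Data.Integer using (ℤ; 0ℤ)
import Data.Integer as ℤ
import Data.Integer.Properties as ℤ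
import Algebra.Properties.AbelianGroup ℤ.+-0-abelianGroup as ℤGroup
open import Data.List.Extrema.Nat using (max; xs≤max)
import Data.List.Relation.Unary.All as All

pattern 0th = here refl
pattern 1st = there 0th
pattern 2nd = there 1st
pattern 3rd = there 2nd

-- Signed branches and derived rules of the calculus.

module Calculus (nm nc : ℕ) where
  open HX nm nc

  infix 6 _⦂_
  _⦂_ : Nom → Form → SF
  _⦂_ = atS

  data Signed : Set where
    T F : SF → Signed

  Branch : Set
  Branch = List Signed

  lefts rights : Branch → List SF
  lefts []          = []
  lefts (T χ ∷ B)   = χ ∷ lefts B
  lefts (F χ ∷ B)   = lefts B
  rights []         = []
  rights (T χ ∷ B)  = rights B
  rights (F χ ∷ B)  = χ ∷ rights B

  -- A record rather than a synonym: `lefts` and `rights` are not injective, so only a rigid head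
  -- lets `B` be inferred.
  record Closed (B : Branch) : Set where
    constructor closed
    field derivation : lefts B ⊢G rights B
  open Closed public

  private variable
    B B′ : Branch
    Γ Δ Γ′ Δ′ : List SF
    χ : SF
    x y z s r : Nom
    φ ψ ξ : Form
    α β : Path
    a : Mod
    c : Cmp

  ∈-lefts⁺ : T χ ∈ B → χ ∈ lefts B
  ∈-lefts⁺ {B = T _ ∷ _} 0th        = 0th
  ∈-lefts⁺ {B = T _ ∷ _} (there e)  = there (∈-lefts⁺ e)
  ∈-lefts⁺ {B = F _ ∷ _} (there e)  = ∈-lefts⁺ e

  ∈-lefts⁻ : χ ∈ lefts B → T χ ∈ B
  ∈-lefts⁻ {B = T _ ∷ _} 0th        = 0th
  ∈-lefts⁻ {B = T _ ∷ _} (there e)  = there (∈-lefts⁻ e)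
  ∈-lefts⁻ {B = F _ ∷ _} e          = there (∈-lefts⁻ e)

  ∈-rights⁺ : F χ ∈ B → χ ∈ rights B
  ∈-rights⁺ {B = F _ ∷ _} 0th        = 0th
  ∈-rights⁺ {B = F _ ∷ _} (there e)  = there (∈-rights⁺ e)
  ∈-rights⁺ {B = T _ ∷ _} (there e)  = ∈-rights⁺ e

  ∈-rights⁻ : χ ∈ rights B → F χ ∈ B
  ∈-rights⁻ {B = F _ ∷ _} 0th        = 0th
  ∈-rights⁻ {B = F _ ∷ _} (there e)  = there (∈-rights⁻ e)
  ∈-rights⁻ {B = T _ ∷ _} e          = there (∈-rights⁻ e)

  -- Contraction and exchange come along with weakening: once `Γ′` and `Δ′` stand in front, the old
  -- formulas are repetitions, which `reorder` absorbs.
  weaken-⊢ : Γ ⊆ Γ′ → Δ ⊆ Δ′ → Γ ⊢G Δ → Γ′ ⊢G Δ′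
  weaken-⊢ {Γ} {Γ′} {Δ} {Δ′} i j d =
    reorder (absorb i) (absorb j) (wRs Δ′ (wLs Γ′ d))
    where
    wLs : ∀ {Γ Δ} Γ′ → Γ ⊢G Δ → (Γ′ ++ Γ) ⊢G Δ
    wLs []       d = d
    wLs (_ ∷ Γ′) d = wL (wLs Γ′ d)
    wRs : ∀ {Γ Δ} Δ′ → Γ ⊢G Δ → Γ ⊢G (Δ′ ++ Δ)
    wRs []       d = d
    wRs (_ ∷ Δ′) d = wR (wRs Δ′ d)
    absorb : ∀ {Γ Γ′} → Γ ⊆ Γ′ → (Γ′ ++ Γ) ≋ Γ′
    absorb {Γ} {Γ′} i = (λ e → [ id , i ]′ (∈-++⁻ Γ′ e)) , λ e → ∈-++ˡ e
      where
      ∈-++ˡ : ∀ {χ Γ′} → χ ∈ Γ′ → χ ∈ Γ′ ++ Γ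
      ∈-++ˡ (here p)  = here p
      ∈-++ˡ (there e) = there (∈-++ˡ e)

  weaken : B ⊆ B′ → Closed B → Closed B′
  weaken i (closed d) =
    closed (weaken-⊢ (∈-lefts⁺ ∘ i ∘ ∈-lefts⁻) (∈-rights⁺ ∘ i ∘ ∈-rights⁻) d)

  there2 : ∀ {A : Set} {u v w : A} {vs} → w ∈ vs → w ∈ u ∷ v ∷ vs
  there2 = there ∘ there

  ∷-⊆ : ∀ {A : Set} {v : A} {vs ws : List A} → v ∈ ws → vs ⊆ ws → (v ∷ vs) ⊆ ws
  ∷-⊆ e i 0th       = e
  ∷-⊆ e i (there f) = i f

  absorbT : T χ ∈ B → (χ ∷ lefts B) ⊢G rights B → Closed B
  absorbT e d = closed (weaken-⊢ (∷-⊆ (∈-lefts⁺ e) id) id d)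

  absorbF : F χ ∈ B → lefts B ⊢G (χ ∷ rights B) → Closed B
  absorbF e d = closed (weaken-⊢ id (∷-⊆ (∈-rights⁺ e) id) d)

  absorbTT : ∀ {χ χ′} → T χ ∈ B → T χ′ ∈ B → (χ ∷ χ′ ∷ lefts B) ⊢G rights B → Closed B
  absorbTT e e′ d = closed (weaken-⊢ (∷-⊆ (∈-lefts⁺ e) (∷-⊆ (∈-lefts⁺ e′) id)) id d)

  -- Strict upper bounds for the nominals that occur.

  mutual
    boundP : Path → ℕ
    boundP (mod a)   = 0
    boundP (nomP i)  = suc i
    boundP (test φ)  = bound φ
    boundP (seq α β) = boundP α ⊔ boundP β

    bound : Form → ℕ
    bound (prop p)      = 0
    bound (nom i)       = suc i
    bound ⊥'            = 0
    bound (φ ⇒ ψ)       = bound φ ⊔ bound ψ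
    bound (at i φ)      = suc i ⊔ bound φ
    bound (dia a φ)     = bound φ
    bound (cmp α s c β) = boundP α ⊔ boundP β

  boundS : SF → ℕ
  boundS χ = bound ⌜ χ ⌝

  boundB : Branch → ℕ
  boundB []        = 0
  boundB (T χ ∷ B) = boundS χ ⊔ boundB B
  boundB (F χ ∷ B) = boundS χ ⊔ boundB B

  mutual
    occP<bound : ∀ α → OccP x α → x < boundP α
    occP<bound (nomP i)  refl     = ℕ.≤-refl
    occP<bound (test φ)  o        = occ<bound φ o
    occP<bound (seq α β) (inj₁ o) = ℕ.≤-trans (occP<bound α o) (ℕ.m≤m⊔n _ _)
    occP<bound (seq α β) (inj₂ o) = ℕ.≤-trans (occP<bound β o) (ℕ.m≤n⊔m (boundP α) _)

    occ<bound : ∀ φ → OccF x φ → x < bound φ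
    occ<bound (nom i)       refl        = ℕ.≤-refl
    occ<bound (φ ⇒ ψ)       (inj₁ o)    = ℕ.≤-trans (occ<bound φ o) (ℕ.m≤m⊔n _ _)
    occ<bound (φ ⇒ ψ)       (inj₂ o)    = ℕ.≤-trans (occ<bound ψ o) (ℕ.m≤n⊔m (bound φ) _)
    occ<bound (at i φ)      (inj₁ refl) = ℕ.m≤m⊔n (suc i) (bound φ)
    occ<bound (at i φ)      (inj₂ o)    = ℕ.≤-trans (occ<bound φ o) (ℕ.m≤n⊔m (suc i) _)
    occ<bound (dia a φ)     o           = occ<bound φ o
    occ<bound (cmp α s c β) (inj₁ o)    = ℕ.≤-trans (occP<bound α o) (ℕ.m≤m⊔n _ _)
    occ<bound (cmp α s c β) (inj₂ o)    = ℕ.≤-trans (occP<bound β o) (ℕ.m≤n⊔m (boundP α) _)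

  boundT : T χ ∈ B → boundS χ ≤ boundB B
  boundT {B = T χ ∷ B} 0th       = ℕ.m≤m⊔n _ _
  boundT {B = T χ ∷ B} (there e) = ℕ.≤-trans (boundT e) (ℕ.m≤n⊔m (boundS χ) _)
  boundT {B = F χ ∷ B} (there e) = ℕ.≤-trans (boundT e) (ℕ.m≤n⊔m (boundS χ) _)

  boundF : F χ ∈ B → boundS χ ≤ boundB B
  boundF {B = F χ ∷ B} 0th       = ℕ.m≤m⊔n _ _
  boundF {B = F χ ∷ B} (there e) = ℕ.≤-trans (boundF e) (ℕ.m≤n⊔m (boundS χ) _)
  boundF {B = T χ ∷ B} (there e) = ℕ.≤-trans (boundF e) (ℕ.m≤n⊔m (boundS χ) _)

  boundB-mono : B ⊆ B′ → boundB B ≤ boundB B′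
  boundB-mono {[]}      i = z≤n
  boundB-mono {T χ ∷ B} i = ℕ.⊔-lub (boundT (i 0th)) (boundB-mono {B} (i ∘ there))
  boundB-mono {F χ ∷ B} i = ℕ.⊔-lub (boundF (i 0th)) (boundB-mono {B} (i ∘ there))

  fresh-lefts : ∀ B → boundB B ≤ x → ¬ OccL x (lefts B)
  fresh-lefts (T χ ∷ B) b (here o) =
    ℕ.<⇒≱ (occ<bound ⌜ χ ⌝ o) (ℕ.≤-trans (ℕ.m≤m⊔n _ _) b)
  fresh-lefts (T χ ∷ B) b (there o) = fresh-lefts B (ℕ.≤-trans (ℕ.m≤n⊔m (boundS χ) _) b) o
  fresh-lefts (F χ ∷ B) b o = fresh-lefts B (ℕ.≤-trans (ℕ.m≤n⊔m (boundS χ) _) b) o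

  fresh-rights : ∀ B → boundB B ≤ x → ¬ OccL x (rights B)
  fresh-rights (F χ ∷ B) b (here o) =
    ℕ.<⇒≱ (occ<bound ⌜ χ ⌝ o) (ℕ.≤-trans (ℕ.m≤m⊔n _ _) b)
  fresh-rights (F χ ∷ B) b (there o) = fresh-rights B (ℕ.≤-trans (ℕ.m≤n⊔m (boundS χ) _) b) o
  fresh-rights (T χ ∷ B) b o = fresh-rights B (ℕ.≤-trans (ℕ.m≤n⊔m (boundS χ) _) b) o

  fresh : T χ ∈ B → boundB B ≤ x → Fresh x (χ ∷ lefts B) (rights B)
  fresh {χ} {B} e b = left , fresh-rights B b
    where
    left : ¬ OccL _ (χ ∷ lefts B)
    left (here o)  = ℕ.<⇒≱ (occ<bound ⌜ χ ⌝ o) (ℕ.≤-trans (boundT e) b)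
    left (there o) = fresh-lefts B b o

  -- The rules of G, read upwards on branches that keep their principal formulas.

  cutB : Closed (T χ ∷ B) → Closed (F χ ∷ B) → Closed B
  cutB {B = B} (closed l) (closed r) =
    closed (weaken-⊢ (λ e → [ id , id ]′ (∈-++⁻ (lefts B) e))
                     (λ e → [ id , id ]′ (∈-++⁻ (rights B) e)) (cut r l))

  closeAx : AxForm χ → T χ ∈ B → F χ ∈ B → Closed B
  closeAx k e f = closed (weaken-⊢ (∷-⊆ (∈-lefts⁺ e) id) (∷-⊆ (∈-rights⁺ f) id) (ax k))

  close⊥ : T (x ⦂ ⊥') ∈ B → Closed B
  close⊥ e = absorbT e bot

  ⇒L : T (x ⦂ (φ ⇒ ψ)) ∈ B → Closed (F (x ⦂ φ) ∷ B) → Closed (T (x ⦂ ψ) ∷ B) → Closed B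
  ⇒L e (closed l) (closed r) = absorbT e (impL l r)

  ⇒R : F (x ⦂ (φ ⇒ ψ)) ∈ B → Closed (T (x ⦂ φ) ∷ F (x ⦂ ψ) ∷ B) → Closed B
  ⇒R f (closed d) = absorbF f (impR d)

  atLB : T (y ⦂ at x φ) ∈ B → Closed (T (x ⦂ φ) ∷ B) → Closed B
  atLB e (closed d) = absorbT e (atL d)

  atRB : F (y ⦂ at x φ) ∈ B → Closed (F (x ⦂ φ) ∷ B) → Closed B
  atRB f (closed d) = absorbF f (atR d)

  nom-refl : ∀ x → Closed (T (x ⦂ nom x) ∷ B) → Closed B
  nom-refl x (closed d) = closed (atT {i = x} d)

  contract3 : ∀ {χ₁ χ₂ χ₃} → T χ₂ ∈ B → T χ₃ ∈ B → Closed (T χ₁ ∷ B) →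
              (χ₁ ∷ χ₂ ∷ χ₃ ∷ lefts B) ⊢G rights B
  contract3 _ _ (closed d) = weaken-⊢ (λ { 0th → 0th ; (there e) → there (there (there e)) }) id d

  nom-euclid : T (x ⦂ nom y) ∈ B → T (x ⦂ nom z) ∈ B → Closed (T (y ⦂ nom z) ∷ B) → Closed B
  nom-euclid e e′ d = absorbTT e e′ (at5 (contract3 e e′ d))

  S₁B : S1Form φ → T (x ⦂ nom y) ∈ B → T (x ⦂ φ) ∈ B → Closed (T (y ⦂ φ) ∷ B) → Closed B
  S₁B k e e′ d = absorbTT e e′ (S₁ k (contract3 e e′ d))

  S₂B : T (y ⦂ nom z) ∈ B → T (x ⦂ dia a (nom y)) ∈ B →
        Closed (T (x ⦂ dia a (nom z)) ∷ B) → Closed B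
  S₂B e e′ d = absorbTT e e′ (S₂ (contract3 e e′ d))

  S₃B : T (x ⦂ nom y) ∈ B → T (EQ x c z) ∈ B → Closed (T (EQ y c z) ∷ B) → Closed B
  S₃B e e′ d = absorbTT e e′ (S₃ (contract3 e e′ d))

  eq-refl : ∀ c x → Closed (T (EQ x c x) ∷ B) → Closed B
  eq-refl c x (closed d) = closed (eqT {i = x} {c = c} d)

  eq-euclid : T (EQ x c y) ∈ B → T (EQ x c z) ∈ B → Closed (T (EQ y c z) ∷ B) → Closed B
  eq-euclid e e′ d = absorbTT e e′ (eq5 (contract3 e e′ d))

  neqLB : T (NEQ x c y) ∈ B → Closed (F (EQ x c y) ∷ B) → Closed B
  neqLB e (closed d) = absorbT e (neqL d)

  neqRB : F (NEQ x c y) ∈ B → Closed (T (EQ x c y) ∷ B) → Closed B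
  neqRB f (closed d) = absorbF f (neqR d)

  -- `boundB B` exceeds every nominal of the branch, so it serves as eigenvariable and no supply of
  -- fresh names has to be threaded through.
  diaLB : T (x ⦂ dia a φ) ∈ B →
          Closed (T (x ⦂ dia a (nom (boundB B))) ∷ T (boundB B ⦂ φ) ∷ B) → Closed B
  diaLB e (closed d) = absorbT e (diaL (fresh e ℕ.≤-refl) d)

  diaRB : T (x ⦂ dia a (nom y)) ∈ B → F (x ⦂ dia a φ) ∈ B → Closed (F (y ⦂ φ) ∷ B) → Closed B
  diaRB e f (closed d) =
    closed (weaken-⊢ (∷-⊆ (∈-lefts⁺ e) id) (∷-⊆ (∈-rights⁺ f) id) (diaR (weaken-⊢ there there d)))

  cmpLB : ∀ {p} → T (x ⦂ cmp α p c β) ∈ B →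
          let j = boundB B ; k = suc j in
          Closed (T (x ⦂ diaP α (nom j)) ∷ T (x ⦂ diaP β (nom k)) ∷ T (cmpS j p c k) ∷ B) →
          Closed B
  cmpLB e (closed d) =
    absorbT e (cmpL (ℕ.<⇒≢ ℕ.≤-refl) (fresh e ℕ.≤-refl) (fresh e (ℕ.n≤1+n _)) d)

  cmpRB : ∀ {p} → T (x ⦂ diaP α (nom y)) ∈ B → T (x ⦂ diaP β (nom z)) ∈ B →
          F (x ⦂ cmp α p c β) ∈ B → Closed (F (cmpS y p c z) ∷ B) → Closed B
  cmpRB e e′ f (closed d) =
    closed (weaken-⊢ (∷-⊆ (∈-lefts⁺ e) (∷-⊆ (∈-lefts⁺ e′) id)) (∷-⊆ (∈-rights⁺ f) id)
             (cmpR (weaken-⊢ (there ∘ there) there d)))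

  -- Equality rules and the general identity rule.

  nom-sym : T (x ⦂ nom y) ∈ B → Closed (T (y ⦂ nom x) ∷ B) → Closed B
  nom-sym {x = x} e d =
    nom-refl x (nom-euclid (there e) 0th (weaken (λ { 0th → 0th ; (there m) → there (there m) }) d))

  eq-sym : T (EQ x c y) ∈ B → Closed (T (EQ y c x) ∷ B) → Closed B
  eq-sym {x = x} {c = c} e d =
    eq-refl c x (eq-euclid (there e) 0th (weaken (λ { 0th → 0th ; (there m) → there (there m) }) d))

  eq-trans : T (EQ x c y) ∈ B → T (EQ y c z) ∈ B → Closed (T (EQ x c z) ∷ B) → Closed B
  eq-trans e e′ d =
    eq-sym e (eq-euclid 0th (there e′) (weaken (λ { 0th → 0th ; (there m) → there (there m) }) d))

  -- (S₃) moves the left end of the reflexive `EQ x c x` along `x ⦂ nom y`, and symmetry turns the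
  -- result round.
  nom⇒eq : ∀ c → T (x ⦂ nom y) ∈ B → Closed (T (EQ x c y) ∷ B) → Closed B
  nom⇒eq {x = x} c e d =
    eq-refl c x (S₃B (there e) 0th (eq-sym 0th
      (weaken (λ { 0th → 0th ; (there m) → there (there (there m)) }) d)))

  mutual
    -- Induction on `φ` down to the atoms of `ax`. Comparisons need no induction on paths, because
    -- the left rule supplies exactly the endpoint formulas that the right rule asks for.
    id-rule : ∀ φ → T (x ⦂ φ) ∈ B → F (x ⦂ φ) ∈ B → Closed B
    id-rule (prop p) e f = closeAx axP e f
    id-rule (nom i)  e f = closeAx axN e f
    id-rule ⊥'       e f = close⊥ e
    id-rule (φ ⇒ ψ)  e f =
      ⇒R f (⇒L (there (there e)) (id-rule φ 1st 0th) (id-rule ψ 0th 2nd))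
    id-rule (at i φ) e f = atLB e (atRB (there f) (id-rule φ 1st 0th))
    id-rule (dia a φ) e f = diaLB e (diaRB 0th (there (there f)) (id-rule φ 2nd 0th))
    id-rule (cmp α p c β) e f =
      cmpLB e (cmpRB 0th 1st (there (there (there f))) (id-cmpS p 3rd 0th))

    id-cmpS : ∀ p → T (cmpS x p c y) ∈ B → F (cmpS x p c y) ∈ B → Closed B
    id-cmpS eqP  e f = closeAx axE e f
    id-cmpS neqP e f = neqLB e (neqRB (there f) (closeAx axE 0th 1st))

  close : ∀ χ → T χ ∈ B → F χ ∈ B → Closed B
  close (atS x φ)      = id-rule φ
  close (cmpS x p c y) = id-cmpS p

  ∧L : T (x ⦂ (φ ∧' ψ)) ∈ B → Closed (T (x ⦂ φ) ∷ T (x ⦂ ψ) ∷ B) → Closed B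
  ∧L {φ = φ} {ψ = ψ} e d =
    ⇒L e (⇒R 0th (⇒R 1st (weaken keep d))) (close⊥ 0th)
    where
    keep : ∀ {v v₁ v₂ v₃ v₄} → (v₁ ∷ v ∷ B) ⊆ (v ∷ v₂ ∷ v₁ ∷ v₃ ∷ v₄ ∷ B)
    keep 0th               = 2nd
    keep (there 0th)       = 0th
    keep (there (there m)) = there (there (there (there (there m))))

  ∧R : T (x ⦂ φ) ∈ B → T (x ⦂ ψ) ∈ B → F (x ⦂ (φ ∧' ψ)) ∈ B → Closed B
  ∧R {φ = φ} {ψ = ψ} e e′ f =
    ⇒R f (⇒L 0th (id-rule φ (there (there (there e))) 0th)
      (⇒L 0th (id-rule ψ (there (there (there (there e′)))) 0th) (close⊥ 0th)))

  -- Replacement of equal nominals.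

  Transfers : Form → Set
  Transfers φ = ∀ {x y B} → T (x ⦂ nom y) ∈ B → T (x ⦂ φ) ∈ B → F (y ⦂ φ) ∈ B → Closed B

  transfer-⊥ : Transfers ⊥'
  transfer-⊥ e t f = close⊥ t

  transfer-⇒ : Transfers φ → Transfers ψ → Transfers (φ ⇒ ψ)
  transfer-⇒ p q e t f =
    ⇒R f (⇒L (there (there t))
      -- The antecedent has to travel back from `y` to `x`.
      (nom-sym (there (there (there e))) (p 0th 2nd 1st))
      (q (there (there (there e))) 0th 2nd))

  transfer-at : Transfers (at s φ)
  transfer-at {φ = φ} e t f = atLB t (atRB (there f) (id-rule φ 1st 0th))

  -- No induction on `φ`: the successor stays the same, and (S₁) moves only the edge that leads to
  -- it.
  transfer-dia : Transfers (dia a φ)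
  transfer-dia {φ = φ} e t f =
    diaLB t (S₁B s1d (there (there e)) 0th
      (diaRB 0th (there (there (there f))) (id-rule φ 3rd 0th)))

  mutual
    transfer : ∀ φ → Transfers φ
    transfer (prop p) e t f = S₁B s1p e t (closeAx axP 0th (there f))
    transfer (nom i)  e t f = nom-euclid e t (closeAx axN 0th (there f))
    transfer ⊥'       = transfer-⊥
    transfer (φ ⇒ ψ)  = transfer-⇒ (transfer φ) (transfer ψ)
    transfer (at i φ) = transfer-at
    transfer (dia a φ) = transfer-dia
    transfer (cmp α p c β) e t f =
      -- The endpoint formulas hold at `x`. Two cuts ask for them at `y`: `transferP` refutes the
      -- negative answers, `cmpRB` uses the positive ones.
      cmpLB t (cutB
        (cutB (cmpRB 1st 0th (there (there2 (there2 f))) (id-cmpS p (there (there2 2nd)) 0th))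
              (transferP β transfer-nom (there (there2 (there2 e))) 3rd 0th))
        (transferP α transfer-nom (there (there (there (there e)))) 1st 0th))
      where
      transfer-nom : ∀ {i} → Transfers (nom i)
      transfer-nom e t f = nom-euclid e t (closeAx axN 0th (there f))

    -- `diaP α φ` is not a subterm of a comparison, so the recursion follows the path instead and
    -- takes the transfer property of the continuation `φ` as a parameter.
    transferP : ∀ α → Transfers φ → Transfers (diaP α φ)
    transferP (mod a)   p = transfer-dia
    transferP (nomP i)  p = transfer-at
    transferP (test ψ)  p = transfer-⇒ (transfer-⇒ (transfer ψ) (transfer-⇒ p transfer-⊥)) transfer-⊥
    transferP (seq α β) p = transferP α (transferP β p)

  -- Paths as lists of steps, and membership in data classes.

  -- Paths are flattened to lists of steps, so that suffixes become tails.

  data Step : Set where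
    smod  : Mod → Step
    snom  : Nom → Step
    stest : Form → Step

  stepPath : Step → Path
  stepPath (smod a)  = mod a
  stepPath (snom i)  = nomP i
  stepPath (stest φ) = test φ

  flat : Path → List Step
  flat (mod a)   = smod a ∷ []
  flat (nomP i)  = snom i ∷ []
  flat (test φ)  = stest φ ∷ []
  flat (seq α β) = flat α ++ flat β

  diaSs : List Step → Form → Form
  diaSs []       φ = φ
  diaSs (σ ∷ σs) φ = diaP (stepPath σ) (diaSs σs φ)

  diaSs-++ : ∀ σs τs → diaSs (σs ++ τs) φ ≡ diaSs σs (diaSs τs φ)
  diaSs-++ []       τs = refl
  diaSs-++ (σ ∷ σs) τs = cong (diaP (stepPath σ)) (diaSs-++ σs τs)

  diaSs-flat : ∀ α → diaSs (flat α) φ ≡ diaP α φ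
  diaSs-flat (mod a)   = refl
  diaSs-flat (nomP i)  = refl
  diaSs-flat (test φ)  = refl
  diaSs-flat (seq α β) =
    trans (diaSs-++ (flat α) (flat β))
      (trans (cong (diaSs (flat α)) (diaSs-flat β)) (diaSs-flat α))

  -- The syntax has no empty path, hence the separate first step.
  path : Step → List Step → Path
  path σ []       = stepPath σ
  path σ (τ ∷ σs) = seq (stepPath σ) (path τ σs)

  diaP-path : ∀ σ σs → diaP (path σ σs) φ ≡ diaSs (σ ∷ σs) φ
  diaP-path σ []       = refl
  diaP-path σ (τ ∷ σs) = cong (diaP (stepPath σ)) (diaP-path τ σs)

  -- The path x:σs does not depend on the point of evaluation, and it makes
  -- sense for σs = [] as well.
  anchored : Nom → List Step → Path
  anchored x σs = path (snom x) σs

  -- Says that x has some σs-successor.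
  loop : Cmp → Nom → List Step → SF
  loop c x σs = x ⦂ cmp (anchored x σs) eqP c (anchored x σs)

  private variable
    σs τs : List Step
    i : Nom

  cmp-memR : T (x ⦂ diaP α (nom y)) ∈ B → T (EQ y c z) ∈ B →
             F (x ⦂ cmp α eqP c (nomP z)) ∈ B → Closed B
  cmp-memR {x = x} {z = z} e q f =
    cutB (cmpRB (there e) 0th (there f) (closeAx axE (there2 q) 0th))
         (atRB 0th (nom-refl z (closeAx axN 0th 1st)))

  opaque
    -- "Some σs-successor of x lies in the c-class of z."
    mem : Cmp → Nom → List Step → Nom → SF
    mem c x σs z = x ⦂ cmp (anchored x σs) eqP c (nomP z)

    -- Together with `memR` this is the whole interface of the opaque `mem`. The left rule for
    -- comparisons yields a successor `j` and a nominal that names `z`; equality of their data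
    -- becomes `EQ j c z`.
    memL : T (mem c x σs z) ∈ B →
           Closed (T (EQ (boundB B) c z) ∷ T (x ⦂ diaSs σs (nom (boundB B))) ∷ B) → Closed B
    memL {c = c} {x = x} {σs = σs} {z = z} {B = B} e d =
      cmpLB e (atLB 0th' (atLB 2nd (nom⇒eq c 0th (eq-sym 0th (eq-trans (there (there (there 3rd))) 0th
        (weaken keep d))))))
      where
      j : Nom
      j = boundB B
      0th' : ∀ {B} → T (x ⦂ at x (diaSs σs (nom j))) ∈ (T (x ⦂ diaP (anchored x σs) (nom j)) ∷ B)
      0th' rewrite diaP-path {nom j} (snom x) σs = 0th
      keep : ∀ {v w v₁ v₂ v₃ v₄ v₅ v₆} →
             (v ∷ w ∷ B) ⊆ (v ∷ v₁ ∷ v₂ ∷ v₃ ∷ w ∷ v₄ ∷ v₅ ∷ v₆ ∷ B)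
      keep 0th               = 0th
      keep (there 0th)       = there 3rd
      keep (there (there m)) = there (there (there (there (there (there (there (there m)))))))

    memR : T (x ⦂ diaSs σs (nom y)) ∈ B → T (EQ y c z) ∈ B → F (mem c x σs z) ∈ B → Closed B
    memR {x = x} {σs = σs} {y = y} e q f =
      cutB (cmp-memR 0th (there q) (there f))
           (atRB (at-form 0th) (id-rule _ (there2 e) 0th))
      where
      at-form : ∀ {B} → F (x ⦂ diaP (anchored x σs) (nom y)) ∈ B → F (x ⦂ at x (diaSs σs (nom y))) ∈ B
      at-form = subst (λ φ → F (x ⦂ φ) ∈ _) (diaP-path (snom x) σs)

  dia-intro : T (x ⦂ dia a (nom y)) ∈ B → T (y ⦂ ξ) ∈ B →
              Closed (T (x ⦂ dia a ξ) ∷ B) → Closed B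
  dia-intro e t d = cutB d (diaRB (there e) 0th (id-rule _ (there2 t) 0th))

  at-intro : T (x ⦂ ξ) ∈ B → Closed (T (y ⦂ at x ξ) ∷ B) → Closed B
  at-intro t d = cutB d (atRB 0th (id-rule _ (there2 t) 0th))

  ∧-intro : T (x ⦂ φ) ∈ B → T (x ⦂ ψ) ∈ B → Closed (T (x ⦂ (φ ∧' ψ)) ∷ B) → Closed B
  ∧-intro t t′ d = cutB d (∧R (there t) (there t′) 0th)

  mem-resp-eq : T (mem c x σs y) ∈ B → T (EQ y c z) ∈ B → F (mem c x σs z) ∈ B → Closed B
  mem-resp-eq e q f = memL e (eq-trans 0th (there2 q) (memR 2nd 0th (there (there2 f))))

  mem-[]-refl : F (mem c x [] x) ∈ B → Closed B
  mem-[]-refl {c = c} {x = x} f = eq-refl c x (nom-refl x (memR 0th 1st (there2 f)))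

  mem-mod : T (x ⦂ dia a (nom y)) ∈ B → T (mem c y σs z) ∈ B → F (mem c x (smod a ∷ σs) z) ∈ B →
            Closed B
  mem-mod e m f = memL m (dia-intro (there2 e) 1st (memR 0th 1st (there (there2 f))))

  mem-nom : T (mem c i σs z) ∈ B → F (mem c x (snom i ∷ σs) z) ∈ B → Closed B
  mem-nom m f = memL m (at-intro 1st (memR 0th 1st (there (there2 f))))

  mem-test : T (x ⦂ ψ) ∈ B → T (mem c x σs z) ∈ B → F (mem c x (stest ψ ∷ σs) z) ∈ B → Closed B
  mem-test t m f = memL m (∧-intro (there2 t) 1st (memR 0th 1st (there (there2 f))))

  mem-transfer : T (x ⦂ nom y) ∈ B → T (mem c x σs z) ∈ B → F (mem c y σs z) ∈ B → Closed B
  mem-transfer e m f =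
    memL m (cutB (memR 0th 1st (there (there2 f))) (transfer _ (there (there2 e)) 2nd 0th))

  mem-intro : T (x ⦂ diaSs σs (nom y)) ∈ B → F (mem c x σs y) ∈ B → Closed B
  mem-intro {y = y} {c = c} e f = eq-refl c y (memR (there e) 0th (there f))

  -- α at x is at least as strong as the sequence of steps σs.
  Spells : Nom → List Step → Path → Set
  Spells x σs α = ∀ {j B} → T (x ⦂ diaSs σs (nom j)) ∈ B →
                  Closed (T (x ⦂ diaP α (nom j)) ∷ B) → Closed B

  spells-flat : ∀ α → Spells x (flat α) α
  spells-flat α {j} e d rewrite diaSs-flat {nom j} α = weaken (∷-⊆ e id) d

  spells-anchored : Spells x σs (anchored x σs)
  spells-anchored {x = x} {σs = σs} {j} e d rewrite diaP-path {nom j} (snom x) σs = at-intro e d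

  cmp-eq : Spells x σs α → Spells x τs β →
           T (mem c x σs z) ∈ B → T (mem c x τs z) ∈ B → F (x ⦂ cmp α eqP c β) ∈ B → Closed B
  cmp-eq p q m n f =
    memL m (memL (there2 n) (p 3rd (q 2nd (eq-sym 2nd (eq-trans (there2 3rd) 0th
      (cmpRB 3rd 2nd (there2 (there2 (there2 (there2 f)))) (closeAx axE 1st 0th)))))))

  -- If the two successors had equal data, so would `y` and `z`, whose classes they lie in.
  cmp-neq : Spells x σs α → Spells x τs β →
            T (mem c x σs y) ∈ B → T (mem c x τs z) ∈ B → F (EQ y c z) ∈ B →
            F (x ⦂ cmp α neqP c β) ∈ B → Closed B
  cmp-neq p q m n g f =
    memL m (memL (there2 n) (p 3rd (q 2nd
      (cmpRB 1st 0th (there2 (there2 (there2 f)))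
        (neqRB 0th (eq-sym (there2 (there2 2nd)) (eq-trans 0th 1st (eq-trans 0th (there2 (there2 2nd))
          (closeAx axE 0th (there (there2 (there2 (there2 (there2 (there2 g)))))))))))))))

  mem⇒loop : T (mem c x σs z) ∈ B → F (loop c x σs) ∈ B → Closed B
  mem⇒loop {σs = σs} m = cmp-eq (spells-anchored {σs = σs}) (spells-anchored {σs = σs}) m m

-- Decidable equality of the syntax.

module Decidability (nm nc : ℕ) where
  open HX nm nc
  open Calculus nm nc

  -- Trees over atoms need one uniform equality test instead of a comparison of all pairs of
  -- constructors. The test is pulled back along the left inverse `uncode`, whose values on other
  -- trees are arbitrary.
  data Code : Set where
    leaf : ℕ ⊎ Mod ⊎ Cmp → Code
    _·_  : Code → Code → Code
  infixr 5 _·_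

  pattern # n = leaf (inj₁ n)
  pattern #ₘ a = leaf (inj₂ (inj₁ a))
  pattern #ₖ c = leaf (inj₂ (inj₂ c))

  _≟ᶜ_ : DecidableEquality Code
  leaf u ≟ᶜ leaf v =
    map′ (cong leaf) (λ { refl → refl }) (Sum.≡-dec ℕ._≟_ (Sum.≡-dec Fin._≟_ Fin._≟_) u v)
  leaf u ≟ᶜ (v · w) = no λ ()
  (t · u) ≟ᶜ leaf v = no λ ()
  (t · u) ≟ᶜ (v · w) with t ≟ᶜ v | u ≟ᶜ w
  ... | yes refl | yes refl = yes refl
  ... | no t≢v   | _        = no λ { refl → t≢v refl }
  ... | yes _    | no u≢w   = no λ { refl → u≢w refl }

  mutual
    code : Form → Code
    code (prop p)         = # 0 · # p
    code (nom i)          = # 1 · # i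
    code ⊥'               = # 2
    code (φ ⇒ ψ)          = # 3 · code φ · code ψ
    code (at i φ)         = # 4 · # i · code φ
    code (dia a φ)        = # 5 · #ₘ a · code φ
    code (cmp α eqP c β)  = # 6 · codeP α · codeP β · #ₖ c
    code (cmp α neqP c β) = # 7 · codeP α · codeP β · #ₖ c

    codeP : Path → Code
    codeP (mod a)   = #ₘ a
    codeP (nomP i)  = # i
    codeP (test φ)  = # 0 · code φ
    codeP (seq α β) = # 1 · codeP α · codeP β

  mutual
    uncode : Code → Form
    uncode (# 0 · # p)           = prop p
    uncode (# 1 · # i)           = nom i
    uncode (# 3 · u · v)         = uncode u ⇒ uncode v
    uncode (# 4 · # i · u)       = at i (uncode u)
    uncode (# 5 · #ₘ a · u)      = dia a (uncode u)
    uncode (# 6 · u · v · #ₖ c)  = cmp (uncodeP u) eqP c (uncodeP v)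
    uncode (# 7 · u · v · #ₖ c)  = cmp (uncodeP u) neqP c (uncodeP v)
    uncode _                     = ⊥'

    uncodeP : Code → Path
    uncodeP (#ₘ a)        = mod a
    uncodeP (# i)         = nomP i
    uncodeP (# 0 · u)     = test (uncode u)
    uncodeP (# 1 · u · v) = seq (uncodeP u) (uncodeP v)
    uncodeP _             = nomP 0

  mutual
    uncode-code : ∀ φ → uncode (code φ) ≡ φ
    uncode-code (prop p)         = refl
    uncode-code (nom i)          = refl
    uncode-code ⊥'               = refl
    uncode-code (φ ⇒ ψ)          = cong₂ _⇒_ (uncode-code φ) (uncode-code ψ)
    uncode-code (at i φ)         = cong (at i) (uncode-code φ)
    uncode-code (dia a φ)        = cong (dia a) (uncode-code φ)
    uncode-code (cmp α eqP c β)  = cong₂ (λ u v → cmp u eqP c v) (uncodeP-codeP α) (uncodeP-codeP β)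
    uncode-code (cmp α neqP c β) = cong₂ (λ u v → cmp u neqP c v) (uncodeP-codeP α) (uncodeP-codeP β)

    uncodeP-codeP : ∀ α → uncodeP (codeP α) ≡ α
    uncodeP-codeP (mod a)   = refl
    uncodeP-codeP (nomP i)  = refl
    uncodeP-codeP (test φ)  = cong test (uncode-code φ)
    uncodeP-codeP (seq α β) = cong₂ seq (uncodeP-codeP α) (uncodeP-codeP β)

  _≟ᶠ_ : DecidableEquality Form
  φ ≟ᶠ ψ = map′ (λ e → trans (sym (uncode-code φ)) (trans (cong uncode e) (uncode-code ψ)))
                (cong code) (code φ ≟ᶜ code ψ)

  _≟ˢ_ : DecidableEquality SF
  atS x φ ≟ˢ atS y ψ with x ℕ.≟ y | φ ≟ᶠ ψ
  ... | yes refl | yes refl = yes refl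
  ... | no x≢y   | _        = no λ { refl → x≢y refl }
  ... | yes _    | no φ≢ψ   = no λ { refl → φ≢ψ refl }
  atS x φ ≟ˢ cmpS y p c z = no λ ()
  cmpS x p c y ≟ˢ atS z φ = no λ ()
  cmpS x p c y ≟ˢ cmpS x′ p′ c′ y′
    -- The form bundles `p`, `c` and `y` into one comparison; the first `y` merely fills the left
    -- slot.
    with x ℕ.≟ x′ | cmp (nomP y) p c (nomP y) ≟ᶠ cmp (nomP y′) p′ c′ (nomP y′)
  ... | yes refl | yes refl = yes refl
  ... | no x≢x′  | _        = no λ { refl → x≢x′ refl }
  ... | yes _    | no ne    = no λ { refl → ne refl }

-- Tableaux as unfinished derivations, composed monadically.

module Tableau (nm nc : ℕ) where
  open HX nm nc
  open Calculus nm nc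

  private variable
    B B′ B₁ B₂ : Branch
    P Q : Branch → Set
    χ : SF
    A : Set

  -- An unfinished derivation of Closed B whose open leaves B′ ⊇ B satisfy P.
  data Tab (P : Branch → Set) (B : Branch) : Set where
    leaf : P B → Tab P B
    shut : Closed B → Tab P B
    step : B ⊆ B′ → (Closed B′ → Closed B) → Tab P B′ → Tab P B
    fork : B ⊆ B₁ → B ⊆ B₂ → (Closed B₁ → Closed B₂ → Closed B) →
           Tab P B₁ → Tab P B₂ → Tab P B

  infixl 1 _>>=_
  _>>=_ : Tab P B → (∀ {B′} → B ⊆ B′ → P B′ → Tab Q B′) → Tab Q B
  leaf p           >>= k = k id p
  shut d           >>= k = shut d
  step i r t       >>= k = step i r (t >>= λ j → k (j ∘ i))
  fork i j r t₁ t₂ >>= k = fork i j r (t₁ >>= λ l → k (l ∘ i)) (t₂ >>= λ l → k (l ∘ j))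

  run : Tab P B → Closed B ⊎ (∃[ B′ ] B ⊆ B′ × P B′)
  run (leaf p) = inj₂ (_ , id , p)
  run (shut d) = inj₁ d
  run (step i r t) with run t
  ... | inj₁ d            = inj₁ (r d)
  ... | inj₂ (B′ , j , p) = inj₂ (B′ , j ∘ i , p)
  run (fork i₁ i₂ r t₁ t₂) with run t₁ | run t₂
  ... | inj₂ (B′ , j , p) | _                 = inj₂ (B′ , j ∘ i₁ , p)
  ... | inj₁ _            | inj₂ (B′ , j , p) = inj₂ (B′ , j ∘ i₂ , p)
  ... | inj₁ d₁           | inj₁ d₂           = inj₁ (r d₁ d₂)

  -- Branches only grow, so a monotone property that was established at one stage survives all later
  -- ones.
  Monotone : (Branch → Set) → Set
  Monotone P = ∀ {B B′} → B ⊆ B′ → P B → P B′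

  AllIn : List A → (A → Branch → Set) → Branch → Set
  AllIn vs P B = ∀ v → v ∈ vs → P v B

  AllBelow : ℕ → (ℕ → Branch → Set) → Branch → Set
  AllBelow n P B = ∀ x → x < n → P x B

  AllIn-mono : ∀ {vs : List A} {P} → (∀ v → Monotone (P v)) → Monotone (AllIn vs P)
  AllIn-mono mono i f v e = mono v i (f v e)

  AllBelow-mono : ∀ {n P} → (∀ x → Monotone (P x)) → Monotone (AllBelow n P)
  AllBelow-mono mono i f x l = mono x i (f x l)

  forList : (P : A → Branch → Set) → (∀ v → Monotone (P v)) → (vs : List A) →
            (∀ v → v ∈ vs → ∀ {B′} → B ⊆ B′ → Tab (P v) B′) → Tab (AllIn vs P) B
  forList P mono []       f = leaf λ v ()
  forList P mono (v ∷ vs) f =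
    f v 0th id >>= λ i p →
    forList P mono vs (λ w e j → f w (there e) (j ∘ i)) >>= λ j ps →
    leaf λ { _ 0th → mono v j p ; w (there e) → ps w e }

  forBelow : (P : ℕ → Branch → Set) → (∀ x → Monotone (P x)) → ∀ n →
             (∀ x → x < n → ∀ {B′} → B ⊆ B′ → Tab (P x) B′) → Tab (AllBelow n P) B
  forBelow P mono zero    f = leaf λ x ()
  forBelow P mono (suc n) f =
    f n ℕ.≤-refl id >>= λ i p →
    forBelow P mono n (λ x l j → f x (ℕ.m<n⇒m<1+n l) (j ∘ i)) >>= λ j ps →
    leaf λ x l → [ ps x , (λ { refl → mono n j p }) ]′ (ℕ.m<1+n⇒m<n∨m≡n l)

  Decided : SF → Branch → Set
  Decided χ B = F χ ∈ B ⊎ T χ ∈ B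

  Decided-mono : ∀ χ → Monotone (Decided χ)
  Decided-mono χ i = Sum.map i i

  split : ∀ χ → Tab P (T χ ∷ B) → Tab P (F χ ∷ B) → Tab P B
  split χ = fork there there cutB

  decide : ∀ χ → Tab (Decided χ) B
  decide χ = split χ (leaf (inj₂ 0th)) (leaf (inj₁ 0th))

  -- Depth bounds the number of modal steps needed to evaluate a form.

  mutual
    depthP : Path → ℕ
    depthP (mod a)   = 1
    depthP (nomP i)  = 0
    depthP (test φ)  = depth φ
    depthP (seq α β) = depthP α + depthP β

    depth : Form → ℕ
    depth (prop p)      = 0
    depth (nom i)       = 0
    depth ⊥'            = 0
    depth (φ ⇒ ψ)       = depth φ ⊔ depth ψ
    depth (at i φ)      = depth φ
    depth (dia a φ)     = suc (depth φ)
    depth (cmp α p c β) = depthP α ⊔ depthP β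

  depthSs : List Step → ℕ
  depthSs []       = 0
  depthSs (σ ∷ σs) = depthP (stepPath σ) + depthSs σs

  depthSs-++ : ∀ σs τs → depthSs (σs ++ τs) ≡ depthSs σs + depthSs τs
  depthSs-++ []       τs = refl
  depthSs-++ (σ ∷ σs) τs =
    trans (cong (depthP (stepPath σ) +_) (depthSs-++ σs τs)) (sym (ℕ.+-assoc (depthP (stepPath σ)) _ _))

  depthSs-flat : ∀ α → depthSs (flat α) ≡ depthP α
  depthSs-flat (mod a)   = refl
  depthSs-flat (nomP i)  = refl
  depthSs-flat (test φ)  = ℕ.+-identityʳ _
  depthSs-flat (seq α β) =
    trans (depthSs-++ (flat α) (flat β)) (cong₂ _+_ (depthSs-flat α) (depthSs-flat β))

  Rel : Nom → Pol → Cmp → Nom → Branch → Set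
  Rel j eqP  c k B = T (EQ j c k) ∈ B
  Rel j neqP c k B = F (EQ j c k) ∈ B

  Rel-mono : ∀ {j k c} p → Monotone (Rel j p c k)
  Rel-mono eqP  i = i
  Rel-mono neqP i = i

  expandRel : ∀ p {j c k} → T (cmpS j p c k) ∈ B → Tab (Rel j p c k) B
  expandRel eqP  e = leaf e
  expandRel neqP e = step there (neqLB e) (leaf 0th)

  -- NEQ literals are traded for EQ literals with the opposite sign.
  Resolved : Signed → Branch → Set
  Resolved (T (cmpS x neqP c y)) B = F (EQ x c y) ∈ B
  Resolved (F (cmpS x neqP c y)) B = T (EQ x c y) ∈ B
  Resolved _                     B = ⊤

  Resolved-mono : ∀ u → Monotone (Resolved u)
  Resolved-mono (T (cmpS x neqP c y)) i = i
  Resolved-mono (F (cmpS x neqP c y)) i = i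
  Resolved-mono (T (cmpS x eqP c y))  i = id
  Resolved-mono (F (cmpS x eqP c y))  i = id
  Resolved-mono (T (atS x φ))         i = id
  Resolved-mono (F (atS x φ))         i = id

  resolve : ∀ u → u ∈ B → Tab (Resolved u) B
  resolve (T (cmpS x neqP c y)) e = step there (neqLB e) (leaf 0th)
  resolve (F (cmpS x neqP c y)) e = step there (neqRB e) (leaf 0th)
  resolve (T (cmpS x eqP c y))  e = leaf tt
  resolve (F (cmpS x eqP c y))  e = leaf tt
  resolve (T (atS x φ))         e = leaf tt
  resolve (F (atS x φ))         e = leaf tt

-- Expansion of points and paths within the forest.

-- Nominals below K₀ are the named points; Φ is the set of forms to be decided.
module Expansion (nm nc : ℕ) (K₀ : ℕ) (Φ : List (HX.Form nm nc)) where
  open HX nm nc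
  open Calculus nm nc
  open Tableau nm nc

  private variable
    B B′ : Branch
    m : ℕ
    x y s j k : Nom
    φ ψ ξ : Form
    α β : Path
    σs : List Step
    a : Mod
    c : Cmp
    p : Pol

  mutual
    -- Being inductive, a value contains the whole finite tree of witnesses below `x`. Only forms of
    -- depth at most `m` are decided, because every modal step into an anonymous point uses up one
    -- unit.
    record Expanded (B : Branch) (m : ℕ) (x : Nom) : Set where
      inductive
      constructor expanded
      field decided : ∀ {φ} → φ ∈ Φ → depth φ ≤ m → F (x ⦂ φ) ∈ B ⊎ (T (x ⦂ φ) ∈ B × Witness B m x φ)

    -- An anonymous point with m modal steps left.
    record Done (B : Branch) (m : ℕ) (x : Nom) : Set where
      inductive
      constructor done
      field
        anonymous : ∀ {s} → s < K₀ → F (x ⦂ nom s) ∈ B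
        expansion : Expanded B m x

    data DiaWitness (B : Branch) (m : ℕ) (x : Nom) (a : Mod) (ξ : Form) : Set where
      named : s < K₀ → T (x ⦂ dia a (nom s)) ∈ B → T (s ⦂ ξ) ∈ B → DiaWitness B m x a ξ
      anon  : T (x ⦂ dia a (nom y)) ∈ B → T (y ⦂ ξ) ∈ B → Done B m y → DiaWitness B m x a ξ

    data Witness (B : Branch) : ℕ → Nom → Form → Set where
      prop : ∀ {p} → Witness B m x (prop p)
      nom  : ∀ {i} → Witness B m x (nom i)
      ⊥'   : Witness B m x ⊥'
      _⇒_  : Witness B m x (φ ⇒ ψ)
      at   : ∀ {i} → Witness B m x (at i φ)
      dia  : DiaWitness B m x a φ → Witness B (suc m) x (dia a φ)
      cmp  : Trace B m x (flat α) j → Trace B m x (flat β) k → Rel j p c k B →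
             Witness B m x (cmp α p c β)

    -- A trace follows σs from x to j through anonymous points and stops as soon
    -- as it meets a named one.
    data Trace (B : Branch) : ℕ → Nom → List Step → Nom → Set where
      end   : T (x ⦂ nom j) ∈ B → Trace B m x [] j
      named : s < K₀ → T (x ⦂ dia a (nom s)) ∈ B → T (s ⦂ diaSs σs (nom j)) ∈ B →
              Trace B m x (smod a ∷ σs) j
      anon  : T (x ⦂ dia a (nom y)) ∈ B → Done B m y → Trace B m y σs j →
              Trace B (suc m) x (smod a ∷ σs) j
      jump  : T (s ⦂ diaSs σs (nom j)) ∈ B → Trace B m x (snom s ∷ σs) j
      check : T (x ⦂ ψ) ∈ B → Trace B m x σs j → Trace B m x (stest ψ ∷ σs) j

  open Expanded public
  open Done public

  mutual
    Expanded-mono : B ⊆ B′ → Expanded B m x → Expanded B′ m x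
    Expanded-mono i (expanded f) = expanded λ e l → decided-mono i (f e l)

    decided-mono : B ⊆ B′ → F (x ⦂ φ) ∈ B ⊎ (T (x ⦂ φ) ∈ B × Witness B m x φ) →
                   F (x ⦂ φ) ∈ B′ ⊎ (T (x ⦂ φ) ∈ B′ × Witness B′ m x φ)
    decided-mono i (inj₁ f)       = inj₁ (i f)
    decided-mono i (inj₂ (t , w)) = inj₂ (i t , Witness-mono i w)

    Done-mono : B ⊆ B′ → Done B m x → Done B′ m x
    Done-mono i (done n e) = done (λ l → i (n l)) (Expanded-mono i e)

    DiaWitness-mono : B ⊆ B′ → DiaWitness B m x a ξ → DiaWitness B′ m x a ξ
    DiaWitness-mono i (named l e t) = named l (i e) (i t)
    DiaWitness-mono i (anon e t d)  = anon (i e) (i t) (Done-mono i d)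

    Witness-mono : B ⊆ B′ → Witness B m x φ → Witness B′ m x φ
    Witness-mono i prop      = prop
    Witness-mono i nom       = nom
    Witness-mono i ⊥'        = ⊥'
    Witness-mono i _⇒_       = _⇒_
    Witness-mono i at        = at
    Witness-mono i (dia w)   = dia (DiaWitness-mono i w)
    Witness-mono i (cmp {p = p} t u r) = cmp (Trace-mono i t) (Trace-mono i u) (Rel-mono p i r)

    Trace-mono : B ⊆ B′ → Trace B m x σs j → Trace B′ m x σs j
    Trace-mono i (end e)       = end (i e)
    Trace-mono i (named l e t) = named l (i e) (i t)
    Trace-mono i (anon e d t)  = anon (i e) (Done-mono i d) (Trace-mono i t)
    Trace-mono i (jump t)      = jump (i t)
    Trace-mono i (check t u)   = check (i t) (Trace-mono i u)

  findName : ∀ {P : Branch → Set} n y →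
             (∀ {s B′} → s < n → B ⊆ B′ → T (y ⦂ nom s) ∈ B′ → Tab P B′) →
             (∀ {B′} → B ⊆ B′ → (∀ {s} → s < n → F (y ⦂ nom s) ∈ B′) → Tab P B′) → Tab P B
  findName zero    y found none = none id λ ()
  findName (suc n) y found none =
    split (y ⦂ nom n) (found ℕ.≤-refl there 0th)
      (findName n y (λ l i → found (ℕ.m<n⇒m<1+n l) (i ∘ there)) λ i f →
        none (i ∘ there) λ l → [ f , (λ { refl → i 0th }) ]′ (ℕ.m<1+n⇒m<n∨m≡n l))

  mutual
    -- The new successor is compared with all named points. If it equals `s`, then (S₂) redirects
    -- the edge to `s` and `transfer` carries `ξ` there, so nothing is left to expand. Otherwise it
    -- is anonymous and roots a tree of depth `m`.
    expandDia : ∀ m → T (x ⦂ dia a ξ) ∈ B → Tab (λ B′ → DiaWitness B′ m x a ξ) B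
    expandDia {ξ = ξ} {B = B} m e =
      step there2 (diaLB e)
        (findName K₀ (boundB B)
          (λ l i n → step there (S₂B n (i 0th))
            (split (_ ⦂ ξ)
              (leaf (named l 1st 0th))
              (shut (transfer ξ (there2 n) (there2 (i 1st)) 0th))))
          (λ i n → expandDone m n >>= λ j d → leaf (anon (j (i 0th)) (j (i 1st)) d)))

    expandDone : ∀ m → (∀ {s} → s < K₀ → F (x ⦂ nom s) ∈ B) → Tab (λ B′ → Done B′ m x) B
    expandDone m n = expandPoint m _ >>= λ i e → leaf (done (λ l → i (n l)) e)

    expandPoint : ∀ m x → Tab (λ B′ → Expanded B′ m x) B
    expandPoint m x =
      forList (λ φ B′ → depth φ ≤ m → F (x ⦂ φ) ∈ B′ ⊎ (T (x ⦂ φ) ∈ B′ × Witness B′ m x φ))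
              (λ φ i f l → decided-mono i (f l)) Φ (λ φ _ _ → expandForm m x φ) >>= λ _ f →
      leaf (expanded λ e l → f _ e l)

    expandForm : ∀ m x φ →
      Tab (λ B′ → depth φ ≤ m → F (x ⦂ φ) ∈ B′ ⊎ (T (x ⦂ φ) ∈ B′ × Witness B′ m x φ)) B
    expandForm m x φ with depth φ ≤? m
    ... | no  d≰m = leaf λ d≤m → ⊥-elim (d≰m d≤m)
    ... | yes d≤m = split (x ⦂ φ)
      (expandTrue m x φ d≤m 0th >>= λ i w → leaf λ _ → inj₂ (i 0th , w))
      (leaf λ _ → inj₁ 0th)

    expandTrue : ∀ m x φ → depth φ ≤ m → T (x ⦂ φ) ∈ B → Tab (λ B′ → Witness B′ m x φ) B
    expandTrue m x (prop p) d t = leaf prop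
    expandTrue m x (nom i)  d t = leaf nom
    expandTrue m x ⊥'       d t = leaf ⊥'
    expandTrue m x (φ ⇒ ψ)  d t = leaf _⇒_
    expandTrue m x (at i φ) d t = leaf at
    expandTrue (suc m) x (dia a φ) d t = expandDia m t >>= λ _ w → leaf (dia w)
    expandTrue m x (cmp α p c β) d t =
      step (there ∘ there2) (cmpLB t)
        (expandTrace m x (flat α) (depthα d) (flatT α 0th) >>= λ i u →
         expandTrace m x (flat β) (depthβ d) (flatT β (i 1st)) >>= λ j v →
         expandRel p (j (i 2nd)) >>= λ k r →
         leaf (cmp (Trace-mono (k ∘ j) u) (Trace-mono k v) r))
      where
      flatT : ∀ α {j B} → T (x ⦂ diaP α (nom j)) ∈ B → T (x ⦂ diaSs (flat α) (nom j)) ∈ B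
      flatT α = subst (λ φ → T (x ⦂ φ) ∈ _) (sym (diaSs-flat α))
      depthα : depthP α ⊔ depthP β ≤ m → depthSs (flat α) ≤ m
      depthα d rewrite depthSs-flat α = ℕ.≤-trans (ℕ.m≤m⊔n _ _) d
      depthβ : depthP α ⊔ depthP β ≤ m → depthSs (flat β) ≤ m
      depthβ d rewrite depthSs-flat β = ℕ.≤-trans (ℕ.m≤n⊔m (depthP α) _) d

    -- A test takes no modal step, but its depth counts in `depthSs`: the tested form is then within
    -- the depth decided at `x`, whose expansion supplies the witness, and the trace records only
    -- its truth.
    expandTrace : ∀ m x σs → depthSs σs ≤ m → T (x ⦂ diaSs σs (nom j)) ∈ B →
                  Tab (λ B′ → Trace B′ m x σs j) B
    expandTrace m x []             d t = leaf (end t)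
    expandTrace (suc m) x (smod a ∷ σs) (s≤s d) t = expandDia m t >>= λ where
      i (named l e u) → leaf (named l e u)
      i (anon e u y)  → expandTrace m _ σs d u >>= λ j v → leaf (anon (j e) (Done-mono j y) v)
    expandTrace m x (snom i ∷ σs)  d t = step there (atLB t) (leaf (jump 0th))
    expandTrace m x (stest ψ ∷ σs) d t =
      step there2 (∧L t)
        (expandTrace m x σs (ℕ.≤-trans (ℕ.m≤n+m _ (depth ψ)) d) 1st >>= λ i v →
         leaf (check (i 0th) v))

-- Search over finite ranges.

below : ∀ {X : Set} {R : ℕ → Set} n → (∀ x → x < n → X ⊎ R x) → X ⊎ (∀ x → x < n → R x)
below zero    f = inj₂ λ x ()
below (suc n) f with f n ℕ.≤-refl | below n (λ x l → f x (ℕ.m<n⇒m<1+n l))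
... | inj₁ v | _      = inj₁ v
... | inj₂ _ | inj₁ v = inj₁ v
... | inj₂ r | inj₂ g = inj₂ λ x l → [ g x , (λ { refl → r }) ]′ (ℕ.m<1+n⇒m<n∨m≡n l)

within : ∀ {A X : Set} {R : A → Set} vs → (∀ v → v ∈ vs → X ⊎ R v) → X ⊎ (∀ v → v ∈ vs → R v)
within []       f = inj₂ λ v ()
within (v ∷ vs) f with f v 0th | within vs (λ w e → f w (there e))
... | inj₁ u | _      = inj₁ u
... | inj₂ _ | inj₁ u = inj₁ u
... | inj₂ r | inj₂ g = inj₂ λ { _ 0th → r ; w (there e) → g w e }

remove : ∀ {A : Set} {v : A} {vs} → v ∈ vs →
         ∃[ ws ] suc (length ws) ≡ length vs × (∀ {u} → u ∈ vs → v ≡ u ⊎ u ∈ ws)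
remove {vs = v ∷ vs} 0th = vs , refl , λ { 0th → inj₁ refl ; (there e) → inj₂ e }
remove {vs = v ∷ vs} (there e) with remove e
... | ws , l , split = v ∷ ws , cong suc l , λ where
  0th       → inj₂ 0th
  (there f) → Sum.map₂ there (split f)

nonempty : ∀ {A : Set} {v : A} {vs} → v ∈ vs → 0 < length vs
nonempty 0th       = s≤s z≤n
nonempty (there e) = s≤s z≤n

allBits : ℕ → List (List Bool)
allBits zero    = [] ∷ []
allBits (suc n) = cartesianProductWith _∷_ (true ∷ false ∷ []) (allBits n)

∈-allBits : ∀ bs → bs ∈ allBits (length bs)
∈-allBits []           = 0th
∈-allBits (true ∷ bs)  = ∈-cartesianProductWith⁺ _∷_ {xs = true ∷ false ∷ []} 0th (∈-allBits bs)
∈-allBits (false ∷ bs) = ∈-cartesianProductWith⁺ _∷_ {xs = true ∷ false ∷ []} 1st (∈-allBits bs)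

-- Saturation: named points, types of classes, remaining decisions.

-- CP collects the suffixes of the paths in Φ, L bounds all depths.
module Saturation (nm nc : ℕ) (K₀ : ℕ) (Φ : List (HX.Form nm nc))
                  (CP : List (List (Calculus.Step nm nc))) (L : ℕ)
                  (CP-depth : ∀ {σs} → σs ∈ CP → Tableau.depthSs nm nc σs ≤ L) where
  open HX nm nc
  open Calculus nm nc
  open Tableau nm nc
  open Expansion nm nc K₀ Φ

  private variable
    B B′ : Branch
    P : Branch → Set
    x y z s r j k : Nom
    φ ψ ξ : Form
    σs : List Step
    c : Cmp

  -- The nominals found here precede the expansion of types and so lie below `K₁`. `single⇒named`
  -- relies on them.
  Endpoint : Cmp → Nom → List Step → Branch → Set
  Endpoint c s σs B = F (loop c s σs) ∈ B ⊎ (∃[ j ] T (s ⦂ diaSs σs (nom j)) ∈ B)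

  Endpoint-mono : ∀ c s σs → Monotone (Endpoint c s σs)
  Endpoint-mono c s σs i = Sum.map i λ (j , t) → j , i t

  expandEndpoint : ∀ c s σs → Tab (Endpoint c s σs) B
  expandEndpoint c s σs = split (loop c s σs)
    (step (there ∘ there2) (cmpLB 0th) (step there (atLB (strip 0th)) (leaf (inj₂ (_ , 0th)))))
    (leaf (inj₁ 0th))
    where
    strip : ∀ {j B} → T (s ⦂ diaP (anchored s σs) (nom j)) ∈ B → T (s ⦂ at s (diaSs σs (nom j))) ∈ B
    strip = subst (λ φ → T (s ⦂ φ) ∈ _) (diaP-path (snom s) σs)

  record Named (B : Branch) : Set where
    field
      point    : s < K₀ → Expanded B L s
      nom-dec  : s < K₀ → r < K₀ → Decided (s ⦂ nom r) B
      endpoint : s < K₀ → σs ∈ CP → ∀ c → Endpoint c s σs B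
  open Named public

  expandNamed : Tab Named B
  expandNamed =
    forBelow (λ s B → Expanded B L s) (λ _ → Expanded-mono) K₀ (λ s _ _ → expandPoint L s) >>= λ _ ps →
    forBelow (λ s → AllBelow K₀ λ r → Decided (s ⦂ nom r))
      (λ s → AllBelow-mono λ r → Decided-mono (s ⦂ nom r)) K₀
      (λ s _ _ → forBelow _ (λ r → Decided-mono (s ⦂ nom r)) K₀ λ r _ _ → decide (s ⦂ nom r)) >>= λ i ns →
    forBelow (λ s → AllIn CP λ σs → AllIn (allFin nc) λ c → Endpoint c s σs)
      (λ s → AllIn-mono λ σs → AllIn-mono λ c → Endpoint-mono c s σs) K₀
      (λ s _ _ → forList _ (λ σs → AllIn-mono λ c → Endpoint-mono c s σs) CP
        λ σs _ _ → forList _ (λ c → Endpoint-mono c s σs) (allFin nc)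
          λ c _ _ → expandEndpoint c s σs) >>= λ j es →
    leaf (record
      { point    = λ l → Expanded-mono (j ∘ i) (ps _ l)
      ; nom-dec  = λ l l′ → Decided-mono _ j (ns _ l _ l′)
      ; endpoint = λ l e c → es _ l _ e c (∈-allFin c)
      })

  module Types (base : Branch) where

    -- The classes of nominals below K₁ are the named classes.
    K₁ : ℕ
    K₁ = boundB base ⊔ K₀

    -- The questions are functions of the class, so that a type is the list of answers and two
    -- classes can be compared position by position.
    conditions : Cmp → List (Nom → SF)
    conditions c = cartesianProductWith (mem c) (upTo K₀) CP ++ map (λ y → EQ y c) (upTo K₁)

    mem-condition : s < K₀ → σs ∈ CP → mem c s σs ∈ conditions c
    mem-condition {c = c} l e = ∈-++⁺ˡ (∈-cartesianProductWith⁺ (mem c) (∈-upTo⁺ l) e)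

    eq-condition : y < K₁ → EQ y c ∈ conditions c
    eq-condition {c = c} l =
      ∈-++⁺ʳ (cartesianProductWith (mem c) (upTo K₀) CP) (∈-map⁺ (λ y → EQ y c) (∈-upTo⁺ l))

    conditions⁻ : ∀ {q} → q ∈ conditions c →
      (∃[ s ] ∃[ σs ] s < K₀ × σs ∈ CP × q ≡ mem c s σs) ⊎ (∃[ y ] y < K₁ × q ≡ EQ y c)
    conditions⁻ {c} e with ∈-++⁻ (cartesianProductWith (mem c) (upTo K₀) CP) e
    ... | inj₁ m = let s , σs , s∈ , σs∈ , eq = ∈-cartesianProductWith⁻ (mem c) (upTo K₀) CP m in
                   inj₁ (s , σs , ∈-upTo⁻ s∈ , σs∈ , eq)
    ... | inj₂ m = let y , y∈ , eq = ∈-map⁻ (λ y → EQ y c) m in inj₂ (y , ∈-upTo⁻ y∈ , eq)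

    Bit : Branch → Nom → (Nom → SF) → Bool → Set
    Bit B z q true  = T (q z) ∈ B
    Bit B z q false = F (q z) ∈ B

    Bit-mono : ∀ {q b} → B ⊆ B′ → Bit B z q b → Bit B′ z q b
    Bit-mono {b = true}  i = i
    Bit-mono {b = false} i = i

    Bits : Branch → Nom → List (Nom → SF) → List Bool → Set
    Bits B z = Pointwise (Bit B z)

    Bits-mono : ∀ {qs bs} → B ⊆ B′ → Bits B z qs bs → Bits B′ z qs bs
    Bits-mono i = Pointwise.map (λ {_} {b} → Bit-mono {b = b} i)

    decideBits : ∀ z qs → Tab (λ B → ∃ (Bits B z qs)) B
    decideBits z []       = leaf ([] , [])
    decideBits z (q ∷ qs) = decide (q z) >>= λ where
      i (inj₂ t) → decideBits z qs >>= λ j (bs , ps) → leaf (true ∷ bs , j t ∷ ps)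
      i (inj₁ f) → decideBits z qs >>= λ j (bs , ps) → leaf (false ∷ bs , j f ∷ ps)

    Type : Set
    Type = Cmp × List Bool

    HasType : Branch → Nom → Type → Set
    HasType B z (c , bs) = Bits B z (conditions c) bs

    types : List Type
    types = concatMap (λ c → map (c ,_) (allBits (length (conditions c)))) (allFin nc)

    ∈-types : ∀ τ → HasType B z τ → τ ∈ types
    ∈-types (c , bs) h = ∈-concatMap⁺ _ (lose (∈-allFin c)
      (∈-map⁺ (c ,_) (subst (λ n → bs ∈ allBits n) (sym (Pointwise.Pointwise-length h)) (∈-allBits bs))))

    bound₁ : Branch → ℕ
    bound₁ B = boundB B ⊔ K₁

    bound₁-mono : B ⊆ B′ → bound₁ B ≤ bound₁ B′
    bound₁-mono {B} i = ℕ.⊔-monoˡ-≤ K₁ (boundB-mono {B} i)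

    Reached : Branch → Cmp → Nom → Nom → List Step → Set
    Reached B c z s σs = F (mem c s σs z) ∈ B ⊎ (∃[ j ] Trace B L s σs j × T (EQ j c z) ∈ B)

    Reached-mono : B ⊆ B′ → Reached B c z s σs → Reached B′ c z s σs
    Reached-mono i = Sum.map i λ (j , t , e) → j , Trace-mono i t , i e

    -- The traces for this one class serve all classes of the type: by `label-shift`, a suitable
    -- copy gives its members the label of any of them.
    record Realized (B : Branch) (τ : Type) : Set where
      constructor realized
      field
        {class}  : Nom
        class<   : class < bound₁ B
        hasType  : HasType B class τ
        reached  : s < K₀ → σs ∈ CP → Reached B (proj₁ τ) class s σs
    open Realized public

    Realized-mono : ∀ {τ} → B ⊆ B′ → Realized B τ → Realized B′ τ
    Realized-mono {B} i (realized l h r) =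
      realized (ℕ.≤-trans l (bound₁-mono {B} i)) (Bits-mono i h) λ l e → Reached-mono i (r l e)

    -- A cut is made on each membership. Where it holds, `memL` names a successor in the class of
    -- `z`, and `expandTrace` expands the way to it.
    realize : ∀ τ → z < bound₁ B → HasType B z τ → Tab (λ B′ → Realized B′ τ) B
    realize {z} {B} (c , bs) l h =
      forBelow (λ s → AllIn CP λ σs B → Reached B c z s σs) (λ _ → AllIn-mono λ _ → Reached-mono) K₀
        (λ s _ _ → forList _ (λ _ → Reached-mono) CP
          λ σs e _ → split (mem c s σs z)
            (step there2 (memL 0th)
              (expandTrace L s σs (CP-depth e) 1st >>= λ i t → leaf (inj₂ (_ , t , i 0th))))
            (leaf (inj₁ 0th))) >>= λ i r →
      leaf (realized (ℕ.≤-trans l (bound₁-mono {B} i)) (Bits-mono i h) λ l e → r _ l _ e)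

    -- Typing the classes of a branch extends the branch. Hence `core` is kept as the source of
    -- points and witnesses, while types are read off the larger `B`.
    record Complete (B : Branch) : Set where
      constructor complete
      field
        {core}   : Branch
        base⊆    : base ⊆ core
        core⊆    : core ⊆ B
        typed    : z < bound₁ core → ∀ c → ∃[ bs ] HasType B z (c , bs) × Realized core (c , bs)
    open Complete public

    Typed : Cmp → Nom → Branch → Set
    Typed c z B = ∃[ bs ] HasType B z (c , bs)

    Typed-mono : ∀ c z → Monotone (Typed c z)
    Typed-mono c z i (bs , h) = bs , Bits-mono i h

    decideTypes : ∀ n → Tab (AllBelow n λ z → AllIn (allFin nc) λ c → Typed c z) B
    decideTypes n =
      forBelow _ (λ z → AllIn-mono λ c → Typed-mono c z) n λ z _ _ →
        forList _ (λ c → Typed-mono c z) (allFin nc) λ c _ _ → decideBits z (conditions c)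

    -- Every round realizes one of the finitely many types that remain.
    completion : ∀ n τs → length τs ≤ n → base ⊆ B →
      (∀ τ → τ ∈ types → Realized B τ ⊎ τ ∈ τs) → Tab Complete B
    completion {B} n τs l b f =
      decideTypes (bound₁ B) >>= λ i h →
      [ (λ { (z , τ , z< , hz , e) → realizeNext n i z< hz e l })
      , (λ g → leaf (complete b i λ z< c → g _ z< c (∈-allFin c)))
      ]′ (below (bound₁ B) λ z z< → within (allFin nc) λ c c∈ → classify i z< (h z z< c c∈))
      where
      Next : Branch → Set
      Next B′ = ∃[ z ] ∃[ τ ] z < bound₁ B × HasType B′ z τ × τ ∈ τs

      classify : ∀ {B′ c z} → B ⊆ B′ → z < bound₁ B → Typed c z B′ →
                 Next B′ ⊎ (∃[ bs ] HasType B′ z (c , bs) × Realized B (c , bs))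
      classify {c = c} {z} i z< (bs , h) with f (c , bs) (∈-types (c , bs) h)
      ... | inj₁ r = inj₂ (bs , h , r)
      ... | inj₂ e = inj₁ (z , (c , bs) , z< , h , e)

      realizeNext : ∀ {B′ z τ} n → B ⊆ B′ → z < bound₁ B → HasType B′ z τ → τ ∈ τs → length τs ≤ n →
                    Tab Complete B′
      realizeNext zero    i z< h e l = ⊥-elim (ℕ.<⇒≱ (nonempty e) l)
      realizeNext {B′} {τ = τ} (suc n) i z< h e l with remove e
      ... | τs′ , len , rest =
        realize τ (ℕ.≤-trans z< (bound₁-mono {B} i)) h >>= λ j r →
        completion n τs′ (s≤s⁻¹ (ℕ.≤-trans (ℕ.≤-reflexive len) l)) (j ∘ i ∘ b) λ τ′ t → remaining j r (f τ′ t) rest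
        where
        remaining : ∀ {B″ τ′} → B′ ⊆ B″ → Realized B″ τ → Realized B τ′ ⊎ τ′ ∈ τs →
                    (∀ {u} → u ∈ τs → τ ≡ u ⊎ u ∈ τs′) → Realized B″ τ′ ⊎ τ′ ∈ τs′
        remaining j r (inj₁ r′) rest = inj₁ (Realized-mono (j ∘ i) r′)
        remaining j r (inj₂ e) rest with rest e
        ... | inj₁ refl = inj₁ r
        ... | inj₂ e′   = inj₂ e′

  -- The last decisions concern nominals below `K` only and call for no new points. A `mem` that
  -- becomes true at an anonymous point is never traced; it is used only where a comparison false on
  -- the branch has to fail in the model.
  record Saturated (B : Branch) : Set where
    field
      base        : Branch
      isNamed     : Named base
      isComplete  : Types.Complete base B
    open Types base public
    K : ℕ
    K = bound₁ (core isComplete)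
    field
      eq-dec      : x < K → y < K → ∀ c → Decided (EQ x c y) B
      mem-dec     : x < K → σs ∈ CP → z < K → ∀ c → Decided (mem c x σs z) B

  saturate : Tab Saturated B
  saturate =
    expandNamed >>= λ {base} _ N →
    let open Types base in
    completion (length types) types ℕ.≤-refl id (λ τ e → inj₂ e) >>= λ _ C →
    let K = bound₁ (core C) in
    forBelow (λ x → AllBelow K λ y → AllIn (allFin nc) λ c → Decided (EQ x c y))
      (λ x → AllBelow-mono λ y → AllIn-mono λ c → Decided-mono (EQ x c y)) K
      (λ x _ _ → forBelow _ (λ y → AllIn-mono λ c → Decided-mono (EQ x c y)) K
        λ y _ _ → forList _ (λ c → Decided-mono (EQ x c y)) (allFin nc)
          λ c _ _ → decide (EQ x c y)) >>= λ i es →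
    forBelow (λ x → AllIn CP λ σs → AllBelow K λ z → AllIn (allFin nc) λ c → Decided (mem c x σs z))
      (λ x → AllIn-mono λ σs → AllBelow-mono λ z → AllIn-mono λ c → Decided-mono (mem c x σs z)) K
      (λ x _ _ → forList _ (λ σs → AllBelow-mono λ z → AllIn-mono λ c → Decided-mono (mem c x σs z)) CP
        λ σs _ _ → forBelow _ (λ z → AllIn-mono λ c → Decided-mono (mem c x σs z)) K
          λ z _ _ → forList _ (λ c → Decided-mono (mem c x σs z)) (allFin nc)
            λ c _ _ → decide (mem c x σs z)) >>= λ j ms →
    leaf (record
      { base       = base
      ; isNamed    = N
      ; isComplete = complete (base⊆ C) (j ∘ i ∘ core⊆ C)
          λ l c → let bs , h , r = typed C l c in bs , Bits-mono (j ∘ i) h , r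
      ; eq-dec     = λ l l′ c → Decided-mono _ j (es _ l _ l′ c (∈-allFin c))
      ; mem-dec    = λ l e l′ c → ms _ l _ e _ l′ c (∈-allFin c)
      })

-- Hintikka conditions on a finite branch.

module Checks (nm nc : ℕ) (K₀ : ℕ) (Φ : List (HX.Form nm nc)) (Ps : List (HX.Path nm nc))
              (CP : List (List (Calculus.Step nm nc))) (K : ℕ)
              (B : Calculus.Branch nm nc) where
  open HX nm nc
  open Calculus nm nc
  open Decidability nm nc

  private variable
    χ : SF
    X Y : Set

  infix 4 ⊕_ ⊖_
  ⊕_ ⊖_ : SF → Set
  ⊕ χ = T χ ∈ B
  ⊖ χ = F χ ∈ B

  -- All conditions are refutations over finite ranges. Each can be tested by membership in `B`, and
  -- a failed test lists the premisses of a derived rule that closes the branch. Positive facts are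
  -- regained by `settle`.
  record Hintikka : Set where
    field
      consistent  : ⊕ χ → ⊖ χ → ⊥
      h-⊥         : ∀ x → x < K → ⊕ x ⦂ ⊥' → ⊥
      h-⇒⁺        : ∀ x → x < K → ∀ φ → φ ∈ Φ → ∀ ψ → ψ ∈ Φ → ⊕ x ⦂ (φ ⇒ ψ) → ⊕ x ⦂ φ → ⊖ x ⦂ ψ → ⊥
      h-⇒⁻ˡ       : ∀ x → x < K → ∀ φ → φ ∈ Φ → ∀ ψ → ψ ∈ Φ → ⊖ x ⦂ (φ ⇒ ψ) → ⊖ x ⦂ φ → ⊥
      h-⇒⁻ʳ       : ∀ x → x < K → ∀ φ → φ ∈ Φ → ∀ ψ → ψ ∈ Φ → ⊖ x ⦂ (φ ⇒ ψ) → ⊕ x ⦂ ψ → ⊥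
      h-at⁺       : ∀ x → x < K → ∀ i → i < K₀ → ∀ φ → φ ∈ Φ → ⊕ x ⦂ at i φ → ⊖ i ⦂ φ → ⊥
      h-at⁻       : ∀ x → x < K → ∀ i → i < K₀ → ∀ φ → φ ∈ Φ → ⊖ x ⦂ at i φ → ⊕ i ⦂ φ → ⊥
      h-dia       : ∀ x → x < K → ∀ y → y < K → ∀ a → a ∈ allFin nm → ∀ φ → φ ∈ Φ →
                    ⊕ x ⦂ dia a (nom y) → ⊕ y ⦂ φ → ⊖ x ⦂ dia a φ → ⊥
      h-nom-refl  : ∀ s → s < K₀ → ⊖ s ⦂ nom s → ⊥
      h-nom-eucl  : ∀ s → s < K₀ → ∀ r → r < K₀ → ∀ t → t < K₀ →
                    ⊕ s ⦂ nom r → ⊕ s ⦂ nom t → ⊖ r ⦂ nom t → ⊥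
      h-transfer  : ∀ s → s < K₀ → ∀ r → r < K₀ → ∀ φ → φ ∈ Φ → ⊕ s ⦂ nom r → ⊕ s ⦂ φ → ⊖ r ⦂ φ → ⊥
      h-eq-refl   : ∀ x → x < K → ∀ c → c ∈ allFin nc → ⊖ EQ x c x → ⊥
      h-eq-eucl   : ∀ x → x < K → ∀ y → y < K → ∀ z → z < K → ∀ c → c ∈ allFin nc →
                    ⊕ EQ x c y → ⊕ EQ x c z → ⊖ EQ y c z → ⊥
      h-nom⇒eq    : ∀ x → x < K → ∀ y → y < K → ∀ c → c ∈ allFin nc → ⊕ x ⦂ nom y → ⊖ EQ x c y → ⊥
      h-mem-refl  : ∀ x → x < K → ∀ c → c ∈ allFin nc → ⊖ mem c x [] x → ⊥
      h-mem-eq    : ∀ x → x < K → ∀ σs → σs ∈ CP → ∀ y → y < K → ∀ z → z < K → ∀ c → c ∈ allFin nc →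
                    ⊕ mem c x σs y → ⊕ EQ y c z → ⊖ mem c x σs z → ⊥
      h-mem-mod   : ∀ x → x < K → ∀ y → y < K → ∀ a → a ∈ allFin nm → ∀ σs → σs ∈ CP → ∀ z → z < K →
                    ∀ c → c ∈ allFin nc →
                    ⊕ x ⦂ dia a (nom y) → ⊕ mem c y σs z → ⊖ mem c x (smod a ∷ σs) z → ⊥
      h-mem-nom   : ∀ x → x < K → ∀ i → i < K₀ → ∀ σs → σs ∈ CP → ∀ z → z < K → ∀ c → c ∈ allFin nc →
                    ⊕ mem c i σs z → ⊖ mem c x (snom i ∷ σs) z → ⊥
      h-mem-test  : ∀ x → x < K → ∀ ψ → ψ ∈ Φ → ∀ σs → σs ∈ CP → ∀ z → z < K → ∀ c → c ∈ allFin nc →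
                    ⊕ x ⦂ ψ → ⊕ mem c x σs z → ⊖ mem c x (stest ψ ∷ σs) z → ⊥
      h-mem-transfer : ∀ s → s < K₀ → ∀ r → r < K₀ → ∀ σs → σs ∈ CP → ∀ z → z < K → ∀ c → c ∈ allFin nc →
                    ⊕ s ⦂ nom r → ⊕ mem c s σs z → ⊖ mem c r σs z → ⊥
      h-mem-intro : ∀ x → x < K → ∀ σs → σs ∈ CP → ∀ j → j < K → ∀ c → c ∈ allFin nc →
                    ⊕ x ⦂ diaSs σs (nom j) → ⊖ mem c x σs j → ⊥
      h-cmp-eq    : ∀ x → x < K → ∀ α → α ∈ Ps → ∀ β → β ∈ Ps → ∀ z → z < K → ∀ c → c ∈ allFin nc →
                    ⊕ mem c x (flat α) z → ⊕ mem c x (flat β) z → ⊖ x ⦂ cmp α eqP c β → ⊥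
      h-cmp-neq   : ∀ x → x < K → ∀ α → α ∈ Ps → ∀ β → β ∈ Ps → ∀ y → y < K → ∀ z → z < K →
                    ∀ c → c ∈ allFin nc →
                    ⊕ mem c x (flat α) y → ⊕ mem c x (flat β) z → ⊖ EQ y c z → ⊖ x ⦂ cmp α neqP c β → ⊥
      h-loop      : ∀ s → s < K₀ → ∀ σs → σs ∈ CP → ∀ z → z < K → ∀ c → c ∈ allFin nc →
                    ⊕ mem c s σs z → ⊖ loop c s σs → ⊥

  _≟_ : DecidableEquality Signed
  T χ ≟ T χ′ = map′ (cong T) (λ { refl → refl }) (χ ≟ˢ χ′)
  F χ ≟ F χ′ = map′ (cong F) (λ { refl → refl }) (χ ≟ˢ χ′)
  T χ ≟ F χ′ = no λ ()
  F χ ≟ T χ′ = no λ ()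

  open DecMembership _≟_ using (_∈?_)

  private
    refute₁ : ∀ u → (u ∈ B → Closed B) → Closed B ⊎ (u ∈ B → ⊥)
    refute₁ u f with u ∈? B
    ... | yes e = inj₁ (f e)
    ... | no ¬e = inj₂ ¬e

    refute₂ : ∀ u v → (u ∈ B → v ∈ B → Closed B) → Closed B ⊎ (u ∈ B → v ∈ B → ⊥)
    refute₂ u v f with u ∈? B
    ... | no ¬e = inj₂ λ e _ → ¬e e
    ... | yes e = [ inj₁ , (λ g → inj₂ λ _ → g) ]′ (refute₁ v (f e))

    refute₃ : ∀ u v w → (u ∈ B → v ∈ B → w ∈ B → Closed B) → Closed B ⊎ (u ∈ B → v ∈ B → w ∈ B → ⊥)
    refute₃ u v w f with u ∈? B
    ... | no ¬e = inj₂ λ e _ _ → ¬e e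
    ... | yes e = [ inj₁ , (λ g → inj₂ λ _ → g) ]′ (refute₂ v w (f e))

    refute₄ : ∀ u v w t → (u ∈ B → v ∈ B → w ∈ B → t ∈ B → Closed B) →
              Closed B ⊎ (u ∈ B → v ∈ B → w ∈ B → t ∈ B → ⊥)
    refute₄ u v w t f with u ∈? B
    ... | no ¬e = inj₂ λ e _ _ _ → ¬e e
    ... | yes e = [ inj₁ , (λ g → inj₂ λ _ → g) ]′ (refute₃ v w t (f e))

    _>>=_ : ∀ {E : Set} → E ⊎ X → (X → E ⊎ Y) → E ⊎ Y
    inj₁ e >>= k = inj₁ e
    inj₂ v >>= k = k v

    Consistent : Signed → Set
    Consistent (T χ) = ⊖ χ → ⊥
    Consistent (F χ) = ⊕ χ → ⊥

    consistent? : ∀ u → u ∈ B → Closed B ⊎ Consistent u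
    consistent? (T χ) e = refute₁ (F χ) (close χ e)
    consistent? (F χ) e = refute₁ (T χ) (λ e′ → close χ e′ e)

  hintikka : Closed B ⊎ Hintikka
  hintikka = do
    h₀ ← within B consistent?
    h₁ ← below K λ x _ → refute₁ (T (x ⦂ ⊥')) close⊥
    h₂ ← below K λ x _ → within Φ λ φ _ → within Φ λ ψ _ →
           refute₃ (T (x ⦂ (φ ⇒ ψ))) (T (x ⦂ φ)) (F (x ⦂ ψ)) λ e t f →
             ⇒L e (id-rule φ (there t) 0th) (id-rule ψ 0th (there f))
    h₃ ← below K λ x _ → within Φ λ φ _ → within Φ λ ψ _ →
           refute₂ (F (x ⦂ (φ ⇒ ψ))) (F (x ⦂ φ)) λ e f → ⇒R e (id-rule φ 0th (there2 f))
    h₄ ← below K λ x _ → within Φ λ φ _ → within Φ λ ψ _ →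
           refute₂ (F (x ⦂ (φ ⇒ ψ))) (T (x ⦂ ψ)) λ e t → ⇒R e (id-rule ψ (there2 t) 1st)
    h₅ ← below K λ x _ → below K₀ λ i _ → within Φ λ φ _ →
           refute₂ (T (x ⦂ at i φ)) (F (i ⦂ φ)) λ e f → atLB e (id-rule φ 0th (there f))
    h₆ ← below K λ x _ → below K₀ λ i _ → within Φ λ φ _ →
           refute₂ (F (x ⦂ at i φ)) (T (i ⦂ φ)) λ e t → atRB e (id-rule φ (there t) 0th)
    h₇ ← below K λ x _ → below K λ y _ → within (allFin nm) λ a _ → within Φ λ φ _ →
           refute₃ (T (x ⦂ dia a (nom y))) (T (y ⦂ φ)) (F (x ⦂ dia a φ)) λ e t f →
             diaRB e f (id-rule φ (there t) 0th)
    h₈ ← below K₀ λ s _ → refute₁ (F (s ⦂ nom s)) λ f → nom-refl s (closeAx axN 0th (there f))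
    h₉ ← below K₀ λ s _ → below K₀ λ r _ → below K₀ λ t _ →
           refute₃ (T (s ⦂ nom r)) (T (s ⦂ nom t)) (F (r ⦂ nom t)) λ e e′ f →
             nom-euclid e e′ (closeAx axN 0th (there f))
    h₁₀ ← below K₀ λ s _ → below K₀ λ r _ → within Φ λ φ _ →
            refute₃ (T (s ⦂ nom r)) (T (s ⦂ φ)) (F (r ⦂ φ)) (transfer φ)
    h₁₁ ← below K λ x _ → within (allFin nc) λ c _ →
            refute₁ (F (EQ x c x)) λ f → eq-refl c x (closeAx axE 0th (there f))
    h₁₂ ← below K λ x _ → below K λ y _ → below K λ z _ → within (allFin nc) λ c _ →
            refute₃ (T (EQ x c y)) (T (EQ x c z)) (F (EQ y c z)) λ e e′ f →
              eq-euclid e e′ (closeAx axE 0th (there f))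
    h₁₃ ← below K λ x _ → below K λ y _ → within (allFin nc) λ c _ →
            refute₂ (T (x ⦂ nom y)) (F (EQ x c y)) λ e f → nom⇒eq c e (closeAx axE 0th (there f))
    h₁₄ ← below K λ x _ → within (allFin nc) λ c _ → refute₁ (F (mem c x [] x)) mem-[]-refl
    h₁₅ ← below K λ x _ → within CP λ σs _ → below K λ y _ → below K λ z _ → within (allFin nc) λ c _ →
            refute₃ (T (mem c x σs y)) (T (EQ y c z)) (F (mem c x σs z)) mem-resp-eq
    h₁₆ ← below K λ x _ → below K λ y _ → within (allFin nm) λ a _ → within CP λ σs _ → below K λ z _ →
          within (allFin nc) λ c _ →
            refute₃ (T (x ⦂ dia a (nom y))) (T (mem c y σs z)) (F (mem c x (smod a ∷ σs) z)) mem-mod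
    h₁₇ ← below K λ x _ → below K₀ λ i _ → within CP λ σs _ → below K λ z _ → within (allFin nc) λ c _ →
            refute₂ (T (mem c i σs z)) (F (mem c x (snom i ∷ σs) z)) mem-nom
    h₁₈ ← below K λ x _ → within Φ λ ψ _ → within CP λ σs _ → below K λ z _ → within (allFin nc) λ c _ →
            refute₃ (T (x ⦂ ψ)) (T (mem c x σs z)) (F (mem c x (stest ψ ∷ σs) z)) mem-test
    h₁₉ ← below K₀ λ s _ → below K₀ λ r _ → within CP λ σs _ → below K λ z _ → within (allFin nc) λ c _ →
            refute₃ (T (s ⦂ nom r)) (T (mem c s σs z)) (F (mem c r σs z)) mem-transfer
    h₂₀ ← below K λ x _ → within CP λ σs _ → below K λ j _ → within (allFin nc) λ c _ →
            refute₂ (T (x ⦂ diaSs σs (nom j))) (F (mem c x σs j)) mem-intro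
    h₂₁ ← below K λ x _ → within Ps λ α _ → within Ps λ β _ → below K λ z _ → within (allFin nc) λ c _ →
            refute₃ (T (mem c x (flat α) z)) (T (mem c x (flat β) z)) (F (x ⦂ cmp α eqP c β))
              (cmp-eq (spells-flat α) (spells-flat β))
    h₂₂ ← below K λ x _ → within Ps λ α _ → within Ps λ β _ → below K λ y _ → below K λ z _ →
          within (allFin nc) λ c _ →
            refute₄ (T (mem c x (flat α) y)) (T (mem c x (flat β) z)) (F (EQ y c z)) (F (x ⦂ cmp α neqP c β))
              (cmp-neq (spells-flat α) (spells-flat β))
    h₂₃ ← below K₀ λ s _ → within CP λ σs _ → below K λ z _ → within (allFin nc) λ c _ →
            refute₂ (T (mem c s σs z)) (F (loop c s σs)) mem⇒loop
    inj₂ (record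
      { consistent = h₀ (T _) ; h-⊥ = h₁ ; h-⇒⁺ = h₂ ; h-⇒⁻ˡ = h₃ ; h-⇒⁻ʳ = h₄ ; h-at⁺ = h₅
      ; h-at⁻ = h₆ ; h-dia = h₇ ; h-nom-refl = h₈ ; h-nom-eucl = h₉ ; h-transfer = h₁₀
      ; h-eq-refl = h₁₁ ; h-eq-eucl = h₁₂ ; h-nom⇒eq = h₁₃ ; h-mem-refl = h₁₄ ; h-mem-eq = h₁₅
      ; h-mem-mod = h₁₆ ; h-mem-nom = h₁₇ ; h-mem-test = h₁₈ ; h-mem-transfer = h₁₉ ; h-mem-intro = h₂₀ ; h-cmp-eq = h₂₁
      ; h-cmp-neq = h₂₂ ; h-loop = h₂₃ })

-- Selects canonical representatives: by `first-cong`, predicates that agree on the list select the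
-- same element. Where some element of the list satisfies the predicate, the default `0` is not
-- reached.
first : (ℕ → Bool) → List ℕ → ℕ
first p []       = 0
first p (x ∷ xs) = if p x then x else first p xs

first-cong : ∀ {p q} xs → (∀ {x} → x ∈ xs → p x ≡ q x) → first p xs ≡ first q xs
first-cong []       f = refl
first-cong {p} {q} (x ∷ xs) f rewrite f 0th with q x
... | true  = refl
... | false = first-cong xs (f ∘ there)

first-true : ∀ {p x} xs → x ∈ xs → p x ≡ true → p (first p xs) ≡ true × first p xs ∈ xs
first-true {p} (y ∷ xs) e h with p y in py
first-true {p} (y ∷ xs) e h         | true  = py , 0th
first-true {p} (y ∷ xs) (there e) h | false = let g , m = first-true xs e h in g , there m
first-true {p} (y ∷ xs) 0th h       | false with () ← trans (sym py) h

map-cong-∈ : ∀ {A B : Set} {f g : A → B} vs → (∀ {v} → v ∈ vs → f v ≡ g v) → map f vs ≡ map g vs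
map-cong-∈ []       h = refl
map-cong-∈ (v ∷ vs) h = cong₂ _∷_ (h 0th) (map-cong-∈ vs (h ∘ there))

map-elim-∈ : ∀ {A B : Set} {f g : A → B} {v} vs → map f vs ≡ map g vs → v ∈ vs → f v ≡ g v
map-elim-∈ (v ∷ vs) h 0th       = ∷-injectiveˡ h
map-elim-∈ (v ∷ vs) h (there e) = map-elim-∈ vs (∷-injectiveʳ h) e

record Closure (nm nc : ℕ) (K₀ : ℕ) (Φ : List (HX.Form nm nc)) (Ps : List (HX.Path nm nc))
               (CP : List (List (Calculus.Step nm nc))) (L : ℕ) : Set where
  open HX nm nc
  open Calculus nm nc
  open Tableau nm nc
  field
    0<K₀        : 0 < K₀
    nom-closed  : ∀ {i} → nom i ∈ Φ → i < K₀
    ⇒-closed    : ∀ {φ ψ} → (φ ⇒ ψ) ∈ Φ → φ ∈ Φ × ψ ∈ Φ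
    at-closed   : ∀ {i φ} → at i φ ∈ Φ → i < K₀ × φ ∈ Φ
    dia-closed  : ∀ {a φ} → dia a φ ∈ Φ → φ ∈ Φ
    cmp-closed  : ∀ {α p c β} → cmp α p c β ∈ Φ → α ∈ Ps × β ∈ Ps
    flat-closed : ∀ {α} → α ∈ Ps → flat α ∈ CP
    tail-closed : ∀ {σ σs} → σ ∷ σs ∈ CP → σs ∈ CP
    snom-closed : ∀ {i σs} → snom i ∷ σs ∈ CP → i < K₀
    test-closed : ∀ {ψ σs} → stest ψ ∷ σs ∈ CP → ψ ∈ Φ
    Φ-depth     : ∀ {φ} → φ ∈ Φ → depth φ ≤ L
    CP-depth    : ∀ {σs} → σs ∈ CP → depthSs σs ≤ L

-- The countermodel of an open saturated branch.

module Countermodel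
  (nm nc : ℕ) (K₀ : ℕ) (Φ : List (HX.Form nm nc)) (Ps : List (HX.Path nm nc))
  (CP : List (List (Calculus.Step nm nc))) (L : ℕ) (cl : Closure nm nc K₀ Φ Ps CP L)
  (B : Calculus.Branch nm nc)
  (S : Saturation.Saturated nm nc K₀ Φ CP L (Closure.CP-depth cl) B)
  (H : Checks.Hintikka nm nc K₀ Φ Ps CP (Saturation.Saturated.K S) B) where

  open HX nm nc
  open Calculus nm nc
  open Decidability nm nc
  open Tableau nm nc
  open Expansion nm nc K₀ Φ
  open Closure cl
  open Saturation nm nc K₀ Φ CP L CP-depth
  open Saturated S
  open Checks nm nc K₀ Φ Ps CP K B using (⊕_; ⊖_; _≟_)
  open Checks.Hintikka H
  open DecMembership _≟_ using (_∈?_)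

  private variable
    a : Mod
    c : Cmp
    i j s r t x y z : Nom
    m : ℕ
    k k′ : ℤ
    φ ψ : Form
    σ : Step
    σs : List Step
    χ χ′ : SF
    q : Nom → SF

  Core : Branch
  Core = core isComplete

  base⊆Core : base ⊆ Core
  base⊆Core = base⊆ isComplete

  Core⊆B : Core ⊆ B
  Core⊆B = core⊆ isComplete

  boundCore≤K : boundB Core ≤ K
  boundCore≤K = ℕ.m≤m⊔n _ _

  K₀≤K₁ : K₀ ≤ K₁
  K₀≤K₁ = ℕ.m≤n⊔m (boundB base) K₀

  K₁≤K : K₁ ≤ K
  K₁≤K = ℕ.m≤n⊔m (boundB Core) K₁

  K₀<⇒K : s < K₀ → s < K
  K₀<⇒K l = ℕ.≤-trans l (ℕ.≤-trans K₀≤K₁ K₁≤K)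

  subject<F : F (x ⦂ φ) ∈ Core → x < K
  subject<F {φ = φ} e = ℕ.≤-trans (ℕ.≤-trans (ℕ.m≤m⊔n _ (bound φ)) (boundF e)) boundCore≤K

  endpoint< : ∀ {A} → T (x ⦂ diaSs σs (nom j)) ∈ A → j < boundB A
  endpoint< {x} {σs} {j} e =
    ℕ.≤-trans (ℕ.≤-trans (bound-diaSs σs) (ℕ.m≤n⊔m (suc x) _)) (boundT e)
    where
    bound-diaP : ∀ {φ} α → bound φ ≤ bound (diaP α φ)
    bound-diaP (mod a)   = ℕ.≤-refl
    bound-diaP (nomP i)  = ℕ.m≤n⊔m (suc i) _
    bound-diaP (test ψ)  = ℕ.≤-trans (ℕ.≤-trans (ℕ.m≤m⊔n _ 0) (ℕ.m≤n⊔m (bound ψ) _)) (ℕ.m≤m⊔n _ 0)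
    bound-diaP (seq α β) = ℕ.≤-trans (bound-diaP β) (bound-diaP α)
    bound-diaSs : ∀ σs → bound (nom j) ≤ bound (diaSs σs (nom j))
    bound-diaSs []       = ℕ.≤-refl
    bound-diaSs (σ ∷ σs) = ℕ.≤-trans (bound-diaSs σs) (bound-diaP (stepPath σ))

  eq<ˡ : T (EQ x c y) ∈ Core → x < K
  eq<ˡ {x} {y = y} e = ℕ.≤-trans (ℕ.≤-trans (ℕ.m≤m⊔n (suc x) (suc y)) (boundT e)) boundCore≤K

  eq<ʳ : T (EQ x c y) ∈ Core → y < K
  eq<ʳ {x} {y = y} e = ℕ.≤-trans (ℕ.≤-trans (ℕ.m≤n⊔m (suc x) (suc y)) (boundT e)) boundCore≤K

  neq<ˡ : F (EQ x c y) ∈ Core → x < K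
  neq<ˡ {x} {y = y} e = ℕ.≤-trans (ℕ.≤-trans (ℕ.m≤m⊔n (suc x) (suc y)) (boundF e)) boundCore≤K

  neq<ʳ : F (EQ x c y) ∈ Core → y < K
  neq<ʳ {x} {y = y} e = ℕ.≤-trans (ℕ.≤-trans (ℕ.m≤n⊔m (suc x) (suc y)) (boundF e)) boundCore≤K

  -- The nominal `0` is named, so anonymity of `x` puts a formula about `x` on the core.
  Done< : Done Core m x → x < K
  Done< d = subject<F (anonymous d 0<K₀)

  -- Turns a Hintikka condition, which only refutes, into a positive fact about a decided formula.
  settle : Decided χ B → ¬ (⊖ χ) → ⊕ χ
  settle (inj₁ f) n = ⊥-elim (n f)
  settle (inj₂ t) n = t

  nom-refl⁺ : s < K₀ → ⊕ s ⦂ nom s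
  nom-refl⁺ l = settle (Decided-mono _ (Core⊆B ∘ base⊆Core) (nom-dec isNamed l l)) (h-nom-refl _ l)

  nom-eucl⁺ : s < K₀ → r < K₀ → t < K₀ → ⊕ s ⦂ nom r → ⊕ s ⦂ nom t → ⊕ r ⦂ nom t
  nom-eucl⁺ l l′ l″ e e′ =
    settle (Decided-mono _ (Core⊆B ∘ base⊆Core) (nom-dec isNamed l′ l″)) (h-nom-eucl _ l _ l′ _ l″ e e′)

  eq-refl⁺ : x < K → ⊕ EQ x c x
  eq-refl⁺ l = settle (eq-dec l l _) (h-eq-refl _ l _ (∈-allFin _))

  eq-eucl⁺ : x < K → y < K → z < K → ⊕ EQ x c y → ⊕ EQ x c z → ⊕ EQ y c z
  eq-eucl⁺ l l′ l″ e e′ = settle (eq-dec l′ l″ _) (h-eq-eucl _ l _ l′ _ l″ _ (∈-allFin _) e e′)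

  eq-sym⁺ : x < K → y < K → ⊕ EQ x c y → ⊕ EQ y c x
  eq-sym⁺ l l′ e = eq-eucl⁺ l l′ l e (eq-refl⁺ l)

  eq-trans⁺ : x < K → y < K → z < K → ⊕ EQ x c y → ⊕ EQ y c z → ⊕ EQ x c z
  eq-trans⁺ l l′ l″ e e′ = eq-eucl⁺ l′ l l″ (eq-sym⁺ l l′ e) e′

  mem-resp⁺ : x < K → σs ∈ CP → y < K → z < K → ⊕ mem c x σs y → ⊕ EQ y c z → ⊕ mem c x σs z
  mem-resp⁺ l e l′ l″ m q =
    settle (mem-dec l e l″ _) (h-mem-eq _ l _ e _ l′ _ l″ _ (∈-allFin _) m q)

  mem-intro⁺ : x < K → σs ∈ CP → j < K → ⊕ x ⦂ diaSs σs (nom j) → ⊕ mem c x σs j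
  mem-intro⁺ l e l′ t = settle (mem-dec l e l′ _) (h-mem-intro _ l _ e _ l′ _ (∈-allFin _) t)

  val : SF → Bool
  val χ = does (T χ ∈? B)

  val-⊕ : ⊕ χ → val χ ≡ true
  val-⊕ {χ} e with T χ ∈? B
  ... | yes _ = refl
  ... | no ¬e = ⊥-elim (¬e e)

  ⊕-val : val χ ≡ true → ⊕ χ
  ⊕-val {χ} h with yes e ← T χ ∈? B = e

  val-cong : (⊕ χ → ⊕ χ′) → (⊕ χ′ → ⊕ χ) → val χ ≡ val χ′
  val-cong {χ} {χ′} f g with T χ ∈? B | T χ′ ∈? B
  ... | yes _ | yes _  = refl
  ... | no _  | no _   = refl
  ... | yes e | no ¬e′ = ⊥-elim (¬e′ (f e))
  ... | no ¬e | yes e′ = ⊥-elim (¬e (g e′))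

  -- Representatives of named points and of data classes.

  ρ : Nom → Nom
  ρ s = first (λ r → val (s ⦂ nom r)) (upTo K₀)

  ρ-spec : s < K₀ → ⊕ s ⦂ nom (ρ s) × ρ s < K₀
  ρ-spec {s} l =
    let h , e = first-true (upTo K₀) (∈-upTo⁺ l) (val-⊕ (nom-refl⁺ l)) in ⊕-val h , ∈-upTo⁻ e

  ρ< : s < K₀ → ρ s < K₀
  ρ< = proj₂ ∘ ρ-spec

  ρ-nom : s < K₀ → ⊕ s ⦂ nom (ρ s)
  ρ-nom = proj₁ ∘ ρ-spec

  ρ-cong : s < K₀ → r < K₀ → ⊕ s ⦂ nom r → ρ s ≡ ρ r
  ρ-cong l l′ e = first-cong (upTo K₀) λ t∈ → let l″ = ∈-upTo⁻ t∈ in val-cong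
    (nom-eucl⁺ l l′ l″ e)
    (nom-eucl⁺ l′ l l″ (nom-eucl⁺ l l′ l e (nom-refl⁺ l)))

  ρ-idem : s < K₀ → ρ (ρ s) ≡ ρ s
  ρ-idem l = sym (ρ-cong l (ρ< l) (ρ-nom l))

  ρ-nom⁻ : s < K₀ → ⊕ ρ s ⦂ nom s
  ρ-nom⁻ l = nom-eucl⁺ l (ρ< l) l (ρ-nom l) (nom-refl⁺ l)

  rep : Cmp → Nom → Nom
  rep c x = first (λ y → val (EQ x c y)) (upTo K)

  rep-spec : x < K → ⊕ EQ x c (rep c x) × rep c x < K
  rep-spec l =
    let h , e = first-true (upTo K) (∈-upTo⁺ l) (val-⊕ (eq-refl⁺ l)) in ⊕-val h , ∈-upTo⁻ e

  rep-cong : x < K → y < K → ⊕ EQ x c y → rep c x ≡ rep c y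
  rep-cong l l′ e = first-cong (upTo K) λ z∈ → let l″ = ∈-upTo⁻ z∈ in val-cong
    (eq-eucl⁺ l l′ l″ e) (eq-eucl⁺ l′ l l″ (eq-sym⁺ l l′ e))

  rep-inj : x < K → y < K → rep c x ≡ rep c y → ⊕ EQ x c y
  rep-inj {x} {y} {c} l l′ h =
    let e , r< = rep-spec {c = c} l ; e′ , _ = rep-spec l′ in
    eq-trans⁺ l r< l′ e (subst (λ r → ⊕ EQ r c y) (sym h) (eq-sym⁺ l′ (subst (_< K) h r<) e′))

  -- Types, colours and labels of data classes.

  type : Cmp → Nom → List Bool
  type c x = map (λ q → val (q x)) (conditions c)

  type-elim : type c x ≡ type c y → q ∈ conditions c → ⊕ q x → ⊕ q y
  type-elim {c} h e t = ⊕-val (trans (sym (map-elim-∈ (conditions c) h e)) (val-⊕ t))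

  -- Every condition is invariant under equality of data, so a type belongs to the class and not to
  -- the nominal.
  type-cong : x < K → y < K → ⊕ EQ x c y → type c x ≡ type c y
  type-cong {x} {y} {c} l l′ e = map-cong-∈ (conditions c) λ q∈ →
    val-cong (respects l l′ e q∈) (respects l′ l (eq-sym⁺ l l′ e) q∈)
    where
    respects : ∀ {x y q} → x < K → y < K → ⊕ EQ x c y → q ∈ conditions c → ⊕ q x → ⊕ q y
    respects l l′ e q∈ t with conditions⁻ q∈
    ... | inj₁ (s , σs , s< , σs∈ , refl) = mem-resp⁺ (K₀<⇒K s<) σs∈ l l′ t e
    ... | inj₂ (z , z< , refl) = eq-trans⁺ (ℕ.≤-trans z< K₁≤K) l l′ t e

  typeBits : ∀ {bs} → (∀ {q b} → Bit B z q b → val (q z) ≡ b) → ∀ {qs} → Bits B z qs bs →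
             map (λ q → val (q z)) qs ≡ bs
  typeBits h []       = refl
  typeBits h (_∷_ {y = b} p ps) = cong₂ _∷_ (h {b = b} p) (typeBits h ps)

  bit-val : ∀ b → Bit B z q b → val (q z) ≡ b
  bit-val true  t = val-⊕ t
  bit-val {z} {q} false f with T (q z) ∈? B
  ... | yes t = ⊥-elim (consistent t f)
  ... | no _  = refl

  HasType⇒type : ∀ {bs} → HasType B z (c , bs) → type c z ≡ bs
  HasType⇒type = typeBits λ {_} {b} → bit-val b

  InNamedClass : Cmp → Nom → Set
  InNamedClass c x = ∃[ y ] y < K₁ × ⊕ EQ y c x

  inNamedClass? : ∀ c x → Dec (InNamedClass c x)
  inNamedClass? c x = ℕ.anyUpTo? (λ y → T (EQ y c x) ∈? B) K₁

  -- Equality with each nominal below `K₁` is one of the conditions, so the type knows whether a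
  -- class is named.
  InNamedClass-type : type c x ≡ type c y → InNamedClass c x → InNamedClass c y
  InNamedClass-type h (z , l , e) = z , l , type-elim h (eq-condition l) e

  -- The class of x in the k-th copy of the forest.  Named classes are shared by
  -- all copies, all others are kept apart by adding k to their representatives.
  colour : Cmp → ℤ → Nom → ℤ
  colour c k x with inNamedClass? c x
  ... | yes _ = 0ℤ
  ... | no _  = ℤ.+ rep c x ℤ.+ k

  label : Cmp → ℤ → Nom → List Bool × ℤ
  label c k x = type c x , colour c k x

  label-cong : x < K → y < K → ⊕ EQ x c y → label c k x ≡ label c k y
  label-cong {x} {y} {c} {k} l l′ e = cong₂ _,_ t≡ colour≡
    where
    t≡ : type c x ≡ type c y
    t≡ = type-cong l l′ e
    colour≡ : colour c k x ≡ colour c k y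
    colour≡ with inNamedClass? c x | inNamedClass? c y
    ... | yes _ | yes _ = refl
    ... | no _  | no _  = cong (λ r → ℤ.+ r ℤ.+ k) (rep-cong l l′ e)
    ... | yes n | no ¬n = ⊥-elim (¬n (InNamedClass-type t≡ n))
    ... | no ¬n | yes n = ⊥-elim (¬n (InNamedClass-type (sym t≡) n))

  -- If the class of `x` is named, the common type carries the equality with that name over to `y`.
  -- Otherwise cancelling the shift `k` leaves equal representatives.
  label-inj : x < K → y < K → label c k x ≡ label c k y → ⊕ EQ x c y
  label-inj {x} {y} {c} {k} l l′ h with inNamedClass? c x | inNamedClass? c y | cong proj₁ h | cong proj₂ h
  ... | yes (z , z< , e) | _     | t≡ | _  =
    let z<K = ℕ.≤-trans z< K₁≤K in eq-eucl⁺ z<K l l′ e (type-elim t≡ (eq-condition z<) e)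
  ... | no ¬n | yes n | t≡ | _  = ⊥-elim (¬n (InNamedClass-type (sym t≡) n))
  ... | no _  | no _  | _  | c≡ =
    rep-inj l l′ (ℤ.+-injective (ℤGroup.∙-cancelʳ k (ℤ.+ rep c x) (ℤ.+ rep c y) c≡))

  label-named : ∀ k k′ → InNamedClass c x → label c k x ≡ label c k′ x
  label-named {c} {x} k k′ n with inNamedClass? c x
  ... | yes _ = refl
  ... | no ¬n = ⊥-elim (¬n n)

  -- For classes without a name one solves `rep c x + k′ = rep c y + k` for `k′`, which needs
  -- negative numbers: hence ℤ-many copies. For named classes any copy will do.
  label-shift : ∀ k → type c x ≡ type c y → ∃[ k′ ] label c k′ x ≡ label c k y
  label-shift {c} {x} {y} k h with inNamedClass? c y | inNamedClass? c x
  ... | yes n | yes _ = k , cong₂ _,_ h refl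
  ... | yes n | no ¬n = ⊥-elim (¬n (InNamedClass-type (sym h) n))
  ... | no ¬n | yes n = ⊥-elim (¬n (InNamedClass-type h n))
  ... | no _  | no _  = ℤ.- ℤ.+ rep c x ℤ.+ (ℤ.+ rep c y ℤ.+ k) ,
                        cong₂ _,_ h (ℤGroup.\\-leftDividesˡ (ℤ.+ rep c x) (ℤ.+ rep c y ℤ.+ k))

  -- Worlds, copies and arrows.

  data World : Set where
    named : Nom → World
    -- The `Done` value is part of the world and supplies its level and its expansion; one nominal
    -- may thus give several worlds.
    anon  : ℤ → ∀ {m x} → Done Core m x → World

  name : World → Nom
  name (named r)        = r
  name (anon k {x = x} d) = x

  level : World → ℕ
  level (named r)        = L
  level (anon k {m = m} d) = m

  copy : World → ℤ
  copy (named r)  = 0ℤ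
  copy (anon k d) = k

  -- `named r` is a world for every `r`, whether or not `r` represents a named point. No arrow and
  -- no nominal below `K₀` leads to an improper world, so truth need only be controlled at proper
  -- ones.
  Proper : World → Set
  Proper (named r)  = r < K₀ × ρ r ≡ r
  Proper (anon k d) = ⊤

  In : World → ℤ → Set
  In (named r)   k = ⊥
  In (anon k′ d) k = k′ ≡ k

  -- A named point has arrows into all copies, an anonymous one only into its own; this is what lets
  -- a trace from a named point be followed in a copy of choice.
  Sees : World → ℤ → Set
  Sees (named r)   k = ⊤
  Sees (anon k′ d) k = k′ ≡ k

  -- The condition on levels keeps enough depth at an anonymous target. A named target has the full
  -- depth `L` and needs no such condition.
  data Arrow (a : Mod) : World → World → Set where
    to-named : ∀ {w r} → s < K₀ → ρ s ≡ r → T (name w ⦂ dia a (nom s)) ∈ Core → Arrow a w (named r)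
    to-anon  : ∀ {w} → Sees w k → level w ≡ suc m → T (name w ⦂ dia a (nom y)) ∈ Core →
               (d : Done Core m y) → Arrow a w (anon k d)

  classOf : Cmp → World → List Bool × ℤ
  classOf c w = label c (copy w) (name w)

  model : Model
  model = record
    { N     = World
    ; point = named 0
    ; R     = Arrow
    ; E     = λ c v w → classOf c v ≡ classOf c w
    ; E-eq  = λ c → record { refl = refl ; sym = sym ; trans = trans }
    ; g     = λ i → named (ρ i)
    ; V     = λ p w → T (name w ⦂ prop p) ∈ B
    }

  open Model model using (g)

  proper-g : s < K₀ → Proper (g s)
  proper-g l = ρ< l , ρ-idem l

  name< : ∀ w → Proper w → name w < K
  name< (named r)  (l , _) = K₀<⇒K l
  name< (anon k d) _       = Done< d

  expansionOf : ∀ w → Proper w → Expanded Core (level w) (name w)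
  expansionOf (named r)  (l , _) = Expanded-mono base⊆Core (point isNamed l)
  expansionOf (anon k d) _       = expansion d

  sees-copy : ∀ w → Sees w (copy w)
  sees-copy (named r)  = tt
  sees-copy (anon k d) = refl

  -- A named point lies in a named class, whose label is the same in every copy.
  classOf-seen : ∀ w → Proper w → Sees w k → classOf c w ≡ label c k (name w)
  classOf-seen {k = k} (named r) (l , _) _ =
    label-named 0ℤ k (r , ℕ.≤-trans l K₀≤K₁ , eq-refl⁺ (K₀<⇒K l))
  classOf-seen (anon k d) _ refl = refl

  PSats : List Step → World → World → Set
  PSats []       w w′ = w ≡ w′
  PSats (σ ∷ σs) w w′ = ∃[ v ] PSat model (stepPath σ) w v × PSats σs v w′

  PSats-++⁺ : ∀ σs {τs w v u} → PSats σs w v → PSats τs v u → PSats (σs ++ τs) w u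
  PSats-++⁺ []       refl          q = q
  PSats-++⁺ (σ ∷ σs) (v , p , ps) q = v , p , PSats-++⁺ σs ps q

  PSats-++⁻ : ∀ σs {τs w u} → PSats (σs ++ τs) w u → ∃[ v ] PSats σs w v × PSats τs v u
  PSats-++⁻ []       q            = _ , refl , q
  PSats-++⁻ (σ ∷ σs) (v , p , q) = let u , ps , q′ = PSats-++⁻ σs q in u , (v , p , ps) , q′

  PSats-flat⁺ : ∀ α {w v} → PSat model α w v → PSats (flat α) w v
  PSats-flat⁺ (mod a)   p            = _ , p , refl
  PSats-flat⁺ (nomP i)  p            = _ , p , refl
  PSats-flat⁺ (test φ)  p            = _ , p , refl
  PSats-flat⁺ (seq α β) (u , p , q) = PSats-++⁺ (flat α) (PSats-flat⁺ α p) (PSats-flat⁺ β q)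

  PSats-flat⁻ : ∀ α {w v} → PSats (flat α) w v → PSat model α w v
  PSats-flat⁻ (mod a)   (_ , p , refl) = p
  PSats-flat⁻ (nomP i)  (_ , p , refl) = p
  PSats-flat⁻ (test φ)  (_ , p , refl) = p
  PSats-flat⁻ (seq α β) ps =
    let u , p , q = PSats-++⁻ (flat α) ps in u , PSats-flat⁻ α p , PSats-flat⁻ β q

  Truth : Form → Set
  Truth φ = φ ∈ Φ → ∀ w → Proper w → depth φ ≤ level w →
            (⊕ name w ⦂ φ → Sat model w φ) × (⊖ name w ⦂ φ → ¬ Sat model w φ)

  -- The path lemmas take the truth of tests as a hypothesis, which the truth lemma discharges by
  -- recursion on subforms.
  TruthTests : List Step → Set
  TruthTests σs = ∀ {ψ} → stest ψ ∈ σs → Truth ψ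

  decided-at : ∀ w → Proper w → φ ∈ Φ → depth φ ≤ level w →
               ⊖ name w ⦂ φ ⊎ (⊕ name w ⦂ φ × Witness Core (level w) (name w) φ)
  decided-at w pw e l = Sum.map Core⊆B (λ (t , v) → Core⊆B t , v) (decided (expansionOf w pw) e l)

  -- From the branch to the model: following traces.

  Arrives : Cmp → List Step → World → ℤ → Nom → Set
  Arrives c σs w k j = ∃[ v ] PSats σs w v × Proper v × classOf c v ≡ label c k j

  mutual
    -- Every class recorded at a named point s is reached from s: its type is
    -- realized by some nominal z* of the core, and a suitable copy of the trace
    -- of z* ends in the given class.
    arrive : ∀ σs → σs ∈ CP → TruthTests σs → s < K₀ → z < K → ∀ k → ⊕ mem c s σs z →
             Arrives c σs (g s) k z
    arrive {s} {z} {c} σs σs∈ tt∈ s< z< k m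
      with typed isComplete z< c
    ... | bs , h , r with reached r (ρ< s<) σs∈ | label-shift k same
      where
      same : type c (class r) ≡ type c z
      same = trans (HasType⇒type (Bits-mono Core⊆B (hasType r))) (sym (HasType⇒type h))
    -- The realizing class has the type of `z`, so its membership cannot be refuted while that of
    -- `z` holds.
    ... | inj₁ f | k′ , eq = ⊥-elim (consistent
            (type-elim (sym (cong proj₁ eq)) (mem-condition (ρ< s<) σs∈)
              (settle (mem-dec (K₀<⇒K (ρ< s<)) σs∈ z< c)
                (h-mem-transfer _ s< _ (ρ< s<) _ σs∈ _ z< _ (∈-allFin c) (ρ-nom s<) m)))
            (Core⊆B f))
    ... | inj₂ (j , t , e) | k′ , eq =
            -- `g s` sees every copy, so the trace can be followed in copy `k′`, where the realizing
            -- class has the label of `z` in copy `k`.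
            let v , p , pv , h = follow σs σs∈ tt∈ t (g s) (proper-g s<) refl refl (CP-depth σs∈) tt in
            v , p , pv , trans h (trans (label-cong (eq<ˡ e) (class< r) (Core⊆B e)) eq)

    -- Where the trace stops at a named point, the rest of the path is a membership recorded there,
    -- and `arrive` continues, possibly in another copy. Each such stop consumes a step, so the
    -- alternation ends.
    follow : ∀ σs → σs ∈ CP → TruthTests σs → Trace Core m x σs j → ∀ w → Proper w → name w ≡ x →
             level w ≡ m → depthSs σs ≤ m → Sees w k → Arrives c σs w k j
    follow [] σs∈ tt∈ (end e) w pw refl refl d sees =
      w , refl , pw , trans (classOf-seen w pw sees) (label-cong (name< w pw) (endpoint<K e)
        (settle (eq-dec (name< w pw) (endpoint<K e) _)
          (h-nom⇒eq _ (name< w pw) _ (endpoint<K e) _ (∈-allFin _) (Core⊆B e))))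
      where
      endpoint<K : ∀ {x j} → T (x ⦂ nom j) ∈ Core → j < K
      endpoint<K e = ℕ.≤-trans (endpoint< {σs = []} e) boundCore≤K
    follow (smod a ∷ σs) σs∈ tt∈ (named {s = s} s< e t) w pw refl refl d sees =
      let v , p , pv , h = arriveAt σs σs∈ tt∈ s< t in
      v , (g s , to-named s< refl e , p) , pv , h
    follow (smod a ∷ σs) σs∈ tt∈ (anon e y t) w pw refl lev d sees =
      let v , p , pv , h = follow σs (tail-closed σs∈) (tt∈ ∘ there) t (anon _ y) tt refl refl
                             (s≤s⁻¹ d) refl in
      v , (anon _ y , to-anon sees lev e y , p) , pv , h
    follow (snom i ∷ σs) σs∈ tt∈ (jump t) w pw refl refl d sees =
      let v , p , pv , h = arriveAt σs σs∈ tt∈ (snom-closed σs∈) t in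
      v , (g i , refl , p) , pv , h
    follow (stest ψ ∷ σs) σs∈ tt∈ (check e t) w pw refl refl d sees =
      let v , p , pv , h = follow σs (tail-closed σs∈) (tt∈ ∘ there) t w pw refl refl
                             (ℕ.≤-trans (ℕ.m≤n+m _ (depth ψ)) d) sees in
      v , (w , (refl , proj₁ (tt∈ 0th (test-closed σs∈) w pw (ℕ.≤-trans (ℕ.m≤m+n _ _) d)) (Core⊆B e)) , p) ,
      pv , h

    arriveAt : ∀ σs → (σ ∷ σs) ∈ CP → TruthTests (σ ∷ σs) → s < K₀ → T (s ⦂ diaSs σs (nom j)) ∈ Core →
               Arrives c σs (g s) k j
    arriveAt σs σs∈ tt∈ s< t =
      arrive σs (tail-closed σs∈) (tt∈ ∘ there) s< j< _
        (mem-intro⁺ (K₀<⇒K s<) (tail-closed σs∈) j< (Core⊆B t))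
      where j< = ℕ.≤-trans (endpoint< {σs = σs} t) boundCore≤K

  -- From the model to the branch: retracing paths.

  -- How a path from w leads to v: either it stays among the anonymous points of
  -- one copy of the forest, or it goes through a named point s.
  Local : World → World → Set
  Local w v = ∃[ k ] In w k × In v k

  Via : Cmp → List Step → World → World → Set
  Via c σs w v = ∃[ s ] ∃[ τs ] s < K₀ × τs ∈ CP × ⊕ mem c s τs (name v) ×
                 (∀ {z} → z < K → ⊕ mem c s τs z → ⊕ mem c (name w) σs z)

  record StepFacts (c : Cmp) (σ : Step) (σs : List Step) (w v : World) : Set where
    constructor facts
    field
      proper  : Proper v
      depth≤  : depthSs σs ≤ level v
      extend  : ∀ {z} → z < K → ⊕ mem c (name v) σs z → ⊕ mem c (name w) (σ ∷ σs) z
      back    : In v k → Sees w k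
  open StepFacts

  -- Memberships are propagated against the direction of the step, from its target to its source,
  -- where the comparison in question is evaluated.
  stepFacts : ∀ σ σs → (σ ∷ σs) ∈ CP → TruthTests (σ ∷ σs) → ∀ w v → Proper w → depthSs (σ ∷ σs) ≤ level w →
              PSat model (stepPath σ) w v → StepFacts c σ σs w v
  stepFacts (smod a) σs σs∈ tt∈ w .(named _) pw d (to-named {s = s} s< refl e) =
    facts (proper-g s<) (CP-depth (tail-closed σs∈)) (λ z< m →
      settle (mem-dec (name< w pw) σs∈ z< _)
        (h-mem-mod _ (name< w pw) _ (K₀<⇒K s<) _ (∈-allFin _) _ (tail-closed σs∈) _ z< _ (∈-allFin _) (Core⊆B e)
          (mem-ρ⁻ s< (tail-closed σs∈) z< m)))
      λ ()
    where
    mem-ρ⁻ : ∀ {s σs z c} → s < K₀ → σs ∈ CP → z < K → ⊕ mem c (ρ s) σs z → ⊕ mem c s σs z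
    mem-ρ⁻ l e z< m = settle (mem-dec (K₀<⇒K l) e z< _)
      (h-mem-transfer _ (ρ< l) _ l _ e _ z< _ (∈-allFin _) (ρ-nom⁻ l) m)
  stepFacts (smod a) σs σs∈ tt∈ w .(anon _ y) pw d (to-anon sees lev e y) =
    facts tt (s≤s⁻¹ (subst (suc (depthSs σs) ≤_) lev d)) (λ z< m →
      settle (mem-dec (name< w pw) σs∈ z< _)
        (h-mem-mod _ (name< w pw) _ (Done< y) _ (∈-allFin _) _ (tail-closed σs∈) _ z< _ (∈-allFin _) (Core⊆B e) m))
      (λ { refl → sees })
  stepFacts (snom i) σs σs∈ tt∈ w .(g i) pw d refl =
    let i< = snom-closed σs∈ ; τs∈ = tail-closed σs∈ in
    facts (proper-g i<) (CP-depth τs∈) (λ z< m →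
      settle (mem-dec (name< w pw) σs∈ z< _)
        (h-mem-nom _ (name< w pw) _ i< _ τs∈ _ z< _ (∈-allFin _)
          (settle (mem-dec (K₀<⇒K i<) τs∈ z< _)
            (h-mem-transfer _ (ρ< i<) _ i< _ τs∈ _ z< _ (∈-allFin _) (ρ-nom⁻ i<) m))))
      λ ()
  stepFacts (stest ψ) σs σs∈ tt∈ w .w pw d (refl , sat) =
    facts pw (ℕ.≤-trans (ℕ.m≤n+m _ (depth ψ)) d) (λ z< m →
      settle (mem-dec (name< w pw) σs∈ z< _)
        (h-mem-test _ (name< w pw) _ (test-closed σs∈) _ (tail-closed σs∈) _ z< _ (∈-allFin _) ψ-true m))
      (in⇒sees w)
    where
    ψ-depth : depth ψ ≤ level w
    ψ-depth = ℕ.≤-trans (ℕ.m≤m+n _ _) d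
    ψ-true : ⊕ name w ⦂ ψ
    ψ-true = [ (λ f → ⊥-elim (proj₂ (tt∈ 0th (test-closed σs∈) w pw ψ-depth) f sat)) , proj₁ ]′
             (decided-at w pw (test-closed σs∈) ψ-depth)
    in⇒sees : ∀ w {k} → In w k → Sees w k
    in⇒sees (anon _ _) h = h

  record Retrace (c : Cmp) (σs : List Step) (w v : World) : Set where
    constructor retraced
    field
      proper : Proper v
      member : ⊕ mem c (name w) σs (name v)
      route  : Via c σs w v ⊎ Local w v
  open Retrace

  -- The first named point on the path gives the route `Via`, since from there on only memberships
  -- are needed. If there is none, all points are anonymous and every arrow stays in one copy.
  retrace : ∀ c σs → σs ∈ CP → TruthTests σs → ∀ w v → Proper w → depthSs σs ≤ level w →
            PSats σs w v → Retrace c σs w v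
  retrace c [] σs∈ tt∈ w .w pw d refl = retraced pw self (route? w pw self)
    where
    self : ⊕ mem c (name w) [] (name w)
    self = settle (mem-dec (name< w pw) σs∈ (name< w pw) c) (h-mem-refl _ (name< w pw) _ (∈-allFin _))
    route? : ∀ w → Proper w → ⊕ mem c (name w) [] (name w) → Via c [] w w ⊎ Local w w
    route? (named r)  (l , _) m = inj₁ (r , [] , l , σs∈ , m , λ _ m → m)
    route? (anon k y) _       m = inj₂ (k , refl , refl)
  retrace c (σ ∷ σs) σs∈ tt∈ w v pw d (u , p , ps) =
    retraced (proper ih) mw (route? w pw mw (route ih) (back f) (extend f))
    where
    f : StepFacts c σ σs w u
    f = stepFacts σ σs σs∈ tt∈ w u pw d p
    ih : Retrace c σs u v
    ih = retrace c σs (tail-closed σs∈) (tt∈ ∘ there) u v (proper f) (depth≤ f) ps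
    mw : ⊕ mem c (name w) (σ ∷ σs) (name v)
    mw = extend f (name< v (proper ih)) (member ih)
    route? : ∀ w → Proper w → ⊕ mem c (name w) (σ ∷ σs) (name v) → Via c σs u v ⊎ Local u v →
             (∀ {k} → In u k → Sees w k) →
             (∀ {z} → z < K → ⊕ mem c (name u) σs z → ⊕ mem c (name w) (σ ∷ σs) z) →
             Via c (σ ∷ σs) w v ⊎ Local w v
    route? (named r)  (l , _) m _ _ _ = inj₁ (r , σ ∷ σs , l , σs∈ , m , λ _ m → m)
    route? (anon k y) _ _ (inj₁ (s , τs , s< , e , m , g)) _ h = inj₁ (s , τs , s< , e , m , λ z< → h z< ∘ g z<)
    route? (anon k y) _ _ (inj₂ (k′ , iu , iv)) b _ = inj₂ (k′ , b iu , iv)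

  -- By `m` the path has a successor, so `Endpoint` supplies a nominal below `K₁`. That nominal is
  -- an endpoint too, and only one class is available for it.
  single⇒named : s < K₀ → σs ∈ CP → y < K → ⊕ mem c s σs y →
    (∀ {z} → z < K → ⊕ mem c s σs z → ⊕ EQ z c y) → InNamedClass c y
  single⇒named {σs = σs} {c = c} s< σs∈ y< m single with endpoint isNamed s< σs∈ c
  ... | inj₁ f = ⊥-elim (h-loop _ s< _ σs∈ _ y< _ (∈-allFin c) m (Core⊆B (base⊆Core f)))
  ... | inj₂ (j , t) =
    j , j< , single (ℕ.≤-trans j< K₁≤K)
      (mem-intro⁺ (K₀<⇒K s<) σs∈ (ℕ.≤-trans j< K₁≤K) (Core⊆B (base⊆Core t)))
    where
    j< : j < K₁
    j< = ℕ.≤-trans (endpoint< {σs = σs} t) (ℕ.m≤m⊔n _ K₀)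

  same-copy : ∀ {w u v} → Local w u → Local w v → copy u ≡ copy v
  same-copy {anon _ _} {anon _ _} {anon _ _} (_ , refl , refl) (_ , refl , refl) = refl

  -- Classes of different copies are only compared along paths that go through
  -- a named point, and there only the types of classes matter.
  module _ {c : Cmp} {α β : Path} {w u v : World} (α∈ : α ∈ Ps) (β∈ : β ∈ Ps) (pw : Proper w)
           (ru : Retrace c (flat α) w u) (rv : Retrace c (flat β) w v) where

    private
      w< = name< w pw
      u< = name< u (proper ru)
      v< = name< v (proper rv)

    -- If the path to `u` runs via `s`, the equal type of the class of `v` makes it a member for `s`
    -- as well, hence for `α` at `w`; so `v` serves both paths. The case of `v` is symmetric. If
    -- neither path meets a named point, both ends lie in one copy, where labels separate classes.
    equal-classes : classOf c u ≡ classOf c v → ⊖ name w ⦂ cmp α eqP c β → ⊥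
    equal-classes h f with route ru | route rv
    ... | inj₁ (s , τs , s< , τs∈ , m , g) | _ =
      h-cmp-eq _ w< _ α∈ _ β∈ _ v< _ (∈-allFin c)
        (g v< (type-elim (cong proj₁ h) (mem-condition s< τs∈) m)) (member rv) f
    ... | inj₂ _ | inj₁ (s , τs , s< , τs∈ , m , g) =
      h-cmp-eq _ w< _ α∈ _ β∈ _ u< _ (∈-allFin c)
        (member ru) (g u< (type-elim (sym (cong proj₁ h)) (mem-condition s< τs∈) m)) f
    ... | inj₂ lu | inj₂ lv =
      h-cmp-eq _ w< _ α∈ _ β∈ _ v< _ (∈-allFin c)
        (mem-resp⁺ w< (flat-closed α∈) u< v< (member ru)
          (label-inj u< v< (subst (λ k → label c (copy u) (name u) ≡ label c k (name v))
                                  (sym (same-copy lu lv)) h)))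
        (member rv) f

    -- A false inequality makes every class reached by `α` equal to every class reached by `β`. A
    -- path via a named point then has a single class of endpoints, which `single⇒named` shows to be
    -- named, so its label does not depend on the copy.
    distinct-classes : classOf c u ≢ classOf c v → ⊖ name w ⦂ cmp α neqP c β → ⊥
    distinct-classes h f = go (route ru) (route rv)
      where
      agree : y < K → z < K → ⊕ mem c (name w) (flat α) y → ⊕ mem c (name w) (flat β) z → ⊕ EQ y c z
      agree y< z< m m′ = settle (eq-dec y< z< c) λ e →
        h-cmp-neq _ w< _ α∈ _ β∈ _ y< _ z< _ (∈-allFin c) m m′ e f
      u≈v : ⊕ EQ (name u) c (name v)
      u≈v = agree u< v< (member ru) (member rv)
      go : Via c (flat α) w u ⊎ Local w u → Via c (flat β) w v ⊎ Local w v → ⊥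
      go (inj₁ (s , τs , s< , τs∈ , m , g)) _ =
        h (trans (label-named (copy u) (copy v) shared) (label-cong u< v< u≈v))
        where
        shared : InNamedClass c (name u)
        shared = single⇒named s< τs∈ u< m λ z< m′ →
          eq-trans⁺ z< v< u< (agree z< v< (g z< m′) (member rv)) (eq-sym⁺ u< v< u≈v)
      go (inj₂ _) (inj₁ (s , τs , s< , τs∈ , m , g)) =
        h (trans (label-cong u< v< u≈v) (label-named (copy u) (copy v) shared))
        where
        shared : InNamedClass c (name v)
        shared = single⇒named s< τs∈ v< m λ z< m′ →
          eq-eucl⁺ u< z< v< (agree u< z< (member ru) (g z< m′)) u≈v
      go (inj₂ lu) (inj₂ lv) =
        h (trans (label-cong u< v< u≈v) (cong (λ k → label c k (name v)) (same-copy lu lv)))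

  -- The truth lemma.

  transfer⁺ : s < K₀ → r < K₀ → φ ∈ Φ → ⊕ s ⦂ nom r → ⊕ s ⦂ φ → ⊕ r ⦂ φ
  transfer⁺ {r = r} s< r< φ∈ e t =
    [ (λ f → ⊥-elim (h-transfer _ s< _ r< _ φ∈ e t (Core⊆B (base⊆Core f)))) , Core⊆B ∘ base⊆Core ∘ proj₁ ]′
      (decided (point isNamed r<) φ∈ (Φ-depth φ∈))

  transfer⁻ : s < K₀ → r < K₀ → φ ∈ Φ → ⊕ s ⦂ nom r → ⊖ r ⦂ φ → ⊖ s ⦂ φ
  transfer⁻ s< r< φ∈ e f =
    [ Core⊆B ∘ base⊆Core , (λ (t , _) → ⊥-elim (h-transfer _ s< _ r< _ φ∈ e (Core⊆B (base⊆Core t)) f)) ]′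
      (decided (point isNamed s<) φ∈ (Φ-depth φ∈))

  dec-named : s < K₀ → φ ∈ Φ → ⊖ s ⦂ φ ⊎ ⊕ s ⦂ φ
  dec-named s< φ∈ = Sum.map (Core⊆B ∘ base⊆Core) (Core⊆B ∘ base⊆Core ∘ proj₁)
                            (decided (point isNamed s<) φ∈ (Φ-depth φ∈))

  true-at : ∀ w → Proper w → φ ∈ Φ → depth φ ≤ level w → ⊕ name w ⦂ φ → Witness Core (level w) (name w) φ
  true-at w pw φ∈ d t = [ (λ f → ⊥-elim (consistent t f)) , proj₂ ]′ (decided-at w pw φ∈ d)

  mutual
    truth : ∀ φ → Truth φ
    truth (prop p) φ∈ w pw d = id , λ f t → consistent t f
    truth (nom i) φ∈ (named r) (r< , ρr) d =
      (λ t → cong named (trans (sym (ρ-cong r< i< t)) ρr)) ,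
      λ { f refl → consistent (ρ-nom⁻ i<) f }
      where i< = nom-closed φ∈
    truth (nom i) φ∈ (anon k y) pw d =
      (λ t → ⊥-elim (consistent t (Core⊆B (anonymous y (nom-closed φ∈))))) , λ _ ()
    truth ⊥' φ∈ w pw d = (λ t → h-⊥ _ (name< w pw) t) , λ _ ()
    truth (φ ⇒ ψ) φψ∈ w pw d = pos , neg
      where
      φ∈ = proj₁ (⇒-closed φψ∈)
      ψ∈ = proj₂ (⇒-closed φψ∈)
      dφ = ℕ.≤-trans (ℕ.m≤m⊔n (depth φ) (depth ψ)) d
      dψ = ℕ.≤-trans (ℕ.m≤n⊔m (depth φ) (depth ψ)) d
      pos : ⊕ name w ⦂ (φ ⇒ ψ) → Sat model w φ → Sat model w ψ
      pos t sφ with decided-at w pw φ∈ dφ | decided-at w pw ψ∈ dψ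
      ... | inj₁ f | _            = ⊥-elim (proj₂ (truth φ φ∈ w pw dφ) f sφ)
      ... | inj₂ _ | inj₂ (t′ , _) = proj₁ (truth ψ ψ∈ w pw dψ) t′
      ... | inj₂ (t′ , _) | inj₁ f = ⊥-elim (h-⇒⁺ _ (name< w pw) _ φ∈ _ ψ∈ t t′ f)
      neg : ⊖ name w ⦂ (φ ⇒ ψ) → ¬ (Sat model w φ → Sat model w ψ)
      neg f s with decided-at w pw φ∈ dφ | decided-at w pw ψ∈ dψ
      ... | inj₁ f′ | _             = h-⇒⁻ˡ _ (name< w pw) _ φ∈ _ ψ∈ f f′
      ... | inj₂ _ | inj₂ (t , _)   = h-⇒⁻ʳ _ (name< w pw) _ φ∈ _ ψ∈ f t
      ... | inj₂ (t , _) | inj₁ f′  =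
        proj₂ (truth ψ ψ∈ w pw dψ) f′ (s (proj₁ (truth φ φ∈ w pw dφ) t))
    truth (at i φ) aφ∈ w pw d = pos , neg
      where
      i< = proj₁ (at-closed aφ∈)
      φ∈ = proj₂ (at-closed aφ∈)
      ih = truth φ φ∈ (g i) (proper-g i<) (Φ-depth φ∈)
      pos : ⊕ name w ⦂ at i φ → Sat model (g i) φ
      pos t = proj₁ ih (transfer⁺ i< (ρ< i<) φ∈ (ρ-nom i<)
        (settle (dec-named i< φ∈) (h-at⁺ _ (name< w pw) _ i< _ φ∈ t)))
      neg : ⊖ name w ⦂ at i φ → ¬ Sat model (g i) φ
      neg f = proj₂ ih (transfer⁻ (ρ< i<) i< φ∈ (ρ-nom⁻ i<)
        ([ id , (λ t → ⊥-elim (h-at⁻ _ (name< w pw) _ i< _ φ∈ f t)) ]′ (dec-named i< φ∈)))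
    truth (dia a φ) aφ∈ w pw d = pos , neg
      where
      φ∈ = dia-closed aφ∈
      at-g : ∀ {s} → s < K₀ → ⊕ s ⦂ φ → Sat model (g s) φ
      at-g s< t = proj₁ (truth φ φ∈ (g _) (proper-g s<) (Φ-depth φ∈)) (transfer⁺ s< (ρ< s<) φ∈ (ρ-nom s<) t)
      witness : ∀ {n x} → Witness Core n x (dia a φ) → name w ≡ x → level w ≡ n → depth (dia a φ) ≤ n →
                Sat model w (dia a φ)
      witness (dia (named s< e t)) refl lev d = g _ , to-named s< refl e , at-g s< (Core⊆B t)
      witness (dia (anon e t y)) refl lev d =
        anon (copy w) y , to-anon (sees-copy w) lev e y , proj₁ (truth φ φ∈ (anon _ y) tt (s≤s⁻¹ d)) (Core⊆B t)
      pos : ⊕ name w ⦂ dia a φ → Sat model w (dia a φ)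
      pos t = witness (true-at w pw aφ∈ d t) refl refl d
      neg : ⊖ name w ⦂ dia a φ → ¬ Sat model w (dia a φ)
      neg f (.(named _) , to-named {s = s} s< refl e , sat) with dec-named s< φ∈
      ... | inj₂ t = h-dia _ (name< w pw) _ (K₀<⇒K s<) _ (∈-allFin a) _ φ∈ (Core⊆B e) t f
      ... | inj₁ f′ = proj₂ (truth φ φ∈ (g s) (proper-g s<) (Φ-depth φ∈))
                        (transfer⁻ (ρ< s<) s< φ∈ (ρ-nom⁻ s<) f′) sat
      neg f (.(anon _ y) , to-anon sees lev e y , sat) =
        [ (λ f′ → proj₂ (truth φ φ∈ (anon _ y) tt d′) f′ sat)
        , (λ (t , _) → h-dia _ (name< w pw) _ (Done< y) _ (∈-allFin a) _ φ∈ (Core⊆B e) t f)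
        -- Only the nominal and the level enter the decision, so copy `0ℤ` can stand for any other.
        ]′ (decided-at (anon 0ℤ y) tt φ∈ d′)
        where d′ = s≤s⁻¹ (subst (depth (dia a φ) ≤_) lev d)
    -- `Sat` computes only once the polarity is a constructor, so `pos` and `neg` abstract it as
    -- `q`.
    truth (cmp α p c β) θ∈ w pw d = pos p refl , neg p refl
      where
      α∈ = proj₁ (cmp-closed θ∈)
      β∈ = proj₂ (cmp-closed θ∈)
      dα : depthSs (flat α) ≤ level w
      dα rewrite depthSs-flat α = ℕ.≤-trans (ℕ.m≤m⊔n (depthP α) (depthP β)) d
      dβ : depthSs (flat β) ≤ level w
      dβ rewrite depthSs-flat β = ℕ.≤-trans (ℕ.m≤n⊔m (depthP α) (depthP β)) d
      pos : ∀ q → q ≡ p → ⊕ name w ⦂ cmp α q c β → Sat model w (cmp α q c β)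
      pos q refl t with true-at w pw θ∈ d t
      ... | cmp {j = j} {k = j′} tα tβ r
        with follow (flat α) (flat-closed α∈) (truthP α) tα w pw refl refl dα (sees-copy w)
           | follow (flat β) (flat-closed β∈) (truthP β) tβ w pw refl refl dβ (sees-copy w)
      ... | u , pu , _ , hu | v , pv , _ , hv = compare q r
        where
        compare : ∀ q → Rel j q c j′ Core → Sat model w (cmp α q c β)
        compare eqP r = u , v , PSats-flat⁻ α pu , PSats-flat⁻ β pv ,
          trans hu (trans (label-cong (eq<ˡ r) (eq<ʳ r) (Core⊆B r)) (sym hv))
        compare neqP r = u , v , PSats-flat⁻ α pu , PSats-flat⁻ β pv ,
          λ e → consistent (label-inj (neq<ˡ r) (neq<ʳ r) (trans (sym hu) (trans e hv))) (Core⊆B r)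
      retraceα : ∀ {u} → PSat model α w u → Retrace c (flat α) w u
      retraceα ps = retrace c (flat α) (flat-closed α∈) (truthP α) w _ pw dα (PSats-flat⁺ α ps)
      retraceβ : ∀ {u} → PSat model β w u → Retrace c (flat β) w u
      retraceβ ps = retrace c (flat β) (flat-closed β∈) (truthP β) w _ pw dβ (PSats-flat⁺ β ps)
      neg : ∀ q → q ≡ p → ⊖ name w ⦂ cmp α q c β → ¬ Sat model w (cmp α q c β)
      neg eqP  refl f (u , v , pu , pv , h) = equal-classes α∈ β∈ pw (retraceα pu) (retraceβ pv) h f
      neg neqP refl f (u , v , pu , pv , h) = distinct-classes α∈ β∈ pw (retraceα pu) (retraceβ pv) h f

    truthP : ∀ α → TruthTests (flat α)
    truthP (test φ)  0th = truth φ
    truthP (seq α β) e   = [ truthP α , truthP β ]′ (∈-++⁻ (flat α) e)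
    truthP (mod a)   (here ())
    truthP (nomP i)  (here ())

  -- Formulas of the sequent in the model.

  classOf-g : s < K₀ → classOf c (g s) ≡ label c 0ℤ s
  classOf-g s< = sym (label-cong s<K ρs<K
    (settle (eq-dec s<K ρs<K _) (h-nom⇒eq _ s<K _ ρs<K _ (∈-allFin _) (ρ-nom s<))))
    where
    s<K = K₀<⇒K s<
    ρs<K = K₀<⇒K (ρ< s<)

  InScope : SF → Set
  InScope (atS s φ)      = s < K₀ × φ ∈ Φ
  InScope (cmpS s p c r) = s < K₀ × r < K₀

  related : s < K₀ → r < K₀ → ⊕ EQ s c r → classOf c (g s) ≡ classOf c (g r)
  related s< r< e =
    trans (classOf-g s<) (trans (label-cong (K₀<⇒K s<) (K₀<⇒K r<) e) (sym (classOf-g r<)))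

  unrelated : s < K₀ → r < K₀ → ⊖ EQ s c r → classOf c (g s) ≢ classOf c (g r)
  unrelated s< r< f h =
    consistent (label-inj (K₀<⇒K s<) (K₀<⇒K r<) (trans (sym (classOf-g s<)) (trans h (classOf-g r<)))) f

  holds : ∀ χ → InScope χ → Resolved (T χ) B → ⊕ χ → Holds model χ
  holds (atS s φ) (s< , φ∈) _ t _ =
    proj₁ (truth φ φ∈ (g s) (proper-g s<) (Φ-depth φ∈)) (transfer⁺ s< (ρ< s<) φ∈ (ρ-nom s<) t)
  holds (cmpS s eqP  c r) (s< , r<) _ t _ = g s , g r , refl , refl , related s< r< t
  holds (cmpS s neqP c r) (s< , r<) f t _ = g s , g r , refl , refl , unrelated s< r< f

  fails : ∀ χ → InScope χ → Resolved (F χ) B → ⊖ χ → ¬ Holds model χ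
  fails (atS s φ) (s< , φ∈) _ f h =
    proj₂ (truth φ φ∈ (g s) (proper-g s<) (Φ-depth φ∈)) (transfer⁻ (ρ< s<) s< φ∈ (ρ-nom⁻ s<) f) (h (g s))
  fails (cmpS s eqP c r) (s< , r<) _ f h with h (g s)
  ... | _ , _ , refl , refl , e = unrelated s< r< f e
  fails (cmpS s neqP c r) (s< , r<) t f h with h (g s)
  ... | _ , _ , refl , refl , ne = ne (related s< r< t)

-- The finite fragment generated by a sequent.

module Subforms (nm nc : ℕ) where
  open HX nm nc
  open Calculus nm nc
  open Tableau nm nc

  mutual
    sub : Form → List Form
    sub φ = φ ∷ proper φ

    proper : Form → List Form
    proper (φ ⇒ ψ)       = sub φ ++ sub ψ
    proper (at i φ)      = sub φ
    proper (dia a φ)     = sub φ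
    proper (cmp α p c β) = subP α ++ subP β
    proper _             = []

    subP : Path → List Form
    subP (test φ)  = sub φ
    subP (seq α β) = subP α ++ subP β
    subP _         = []

  private variable
    φ ψ θ : Form
    α β : Path
    σ : Step
    σs τs : List Step
    i : Nom

  mutual
    sub-trans : ∀ φ → ψ ∈ sub φ → θ ∈ sub ψ → θ ∈ sub φ
    sub-trans φ 0th       e′ = e′
    sub-trans φ (there e) e′ = there (proper-trans φ e e′)

    proper-trans : ∀ φ → ψ ∈ proper φ → θ ∈ sub ψ → θ ∈ proper φ
    proper-trans (φ ⇒ φ′) e e′ with ∈-++⁻ (sub φ) e
    ... | inj₁ m = ∈-++⁺ˡ (sub-trans φ m e′)
    ... | inj₂ m = ∈-++⁺ʳ (sub φ) (sub-trans φ′ m e′)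
    proper-trans (at i φ)  e e′ = sub-trans φ e e′
    proper-trans (dia a φ) e e′ = sub-trans φ e e′
    proper-trans (cmp α p c β) e e′ with ∈-++⁻ (subP α) e
    ... | inj₁ m = ∈-++⁺ˡ (subP-trans α m e′)
    ... | inj₂ m = ∈-++⁺ʳ (subP α) (subP-trans β m e′)

    subP-trans : ∀ α → ψ ∈ subP α → θ ∈ sub ψ → θ ∈ subP α
    subP-trans (test φ)  e e′ = sub-trans φ e e′
    subP-trans (seq α β) e e′ with ∈-++⁻ (subP α) e
    ... | inj₁ m = ∈-++⁺ˡ (subP-trans α m e′)
    ... | inj₂ m = ∈-++⁺ʳ (subP α) (subP-trans β m e′)

  mutual
    sub-bound : ∀ φ → ψ ∈ sub φ → bound ψ ≤ bound φ
    sub-bound φ 0th       = ℕ.≤-refl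
    sub-bound φ (there e) = proper-bound φ e

    proper-bound : ∀ φ → ψ ∈ proper φ → bound ψ ≤ bound φ
    proper-bound (φ ⇒ φ′) e with ∈-++⁻ (sub φ) e
    ... | inj₁ m = ℕ.≤-trans (sub-bound φ m) (ℕ.m≤m⊔n _ _)
    ... | inj₂ m = ℕ.≤-trans (sub-bound φ′ m) (ℕ.m≤n⊔m (bound φ) _)
    proper-bound (at i φ)  e = ℕ.≤-trans (sub-bound φ e) (ℕ.m≤n⊔m (suc i) _)
    proper-bound (dia a φ) e = sub-bound φ e
    proper-bound (cmp α p c β) e with ∈-++⁻ (subP α) e
    ... | inj₁ m = ℕ.≤-trans (subP-bound α m) (ℕ.m≤m⊔n _ _)
    ... | inj₂ m = ℕ.≤-trans (subP-bound β m) (ℕ.m≤n⊔m (boundP α) _)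

    subP-bound : ∀ α → ψ ∈ subP α → bound ψ ≤ boundP α
    subP-bound (test φ)  e = sub-bound φ e
    subP-bound (seq α β) e with ∈-++⁻ (subP α) e
    ... | inj₁ m = ℕ.≤-trans (subP-bound α m) (ℕ.m≤m⊔n _ _)
    ... | inj₂ m = ℕ.≤-trans (subP-bound β m) (ℕ.m≤n⊔m (boundP α) _)

  test∈flat : ∀ α → stest ψ ∈ flat α → ψ ∈ subP α
  test∈flat (mod a)   (here ())
  test∈flat (nomP i)  (here ())
  test∈flat (test φ)  0th = 0th
  test∈flat (seq α β) e with ∈-++⁻ (flat α) e
  ... | inj₁ m = ∈-++⁺ˡ (test∈flat α m)
  ... | inj₂ m = ∈-++⁺ʳ (subP α) (test∈flat β m)

  snom∈flat : ∀ α → snom i ∈ flat α → i < boundP α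
  snom∈flat (mod a)   (here ())
  snom∈flat (test φ)  (here ())
  snom∈flat (nomP i)  0th = ℕ.≤-refl
  snom∈flat (seq α β) e with ∈-++⁻ (flat α) e
  ... | inj₁ m = ℕ.≤-trans (snom∈flat α m) (ℕ.m≤m⊔n _ _)
  ... | inj₂ m = ℕ.≤-trans (snom∈flat β m) (ℕ.m≤n⊔m (boundP α) _)

  ∈-tails-refl : ∀ (σs : List Step) → σs ∈ tails σs
  ∈-tails-refl []       = 0th
  ∈-tails-refl (σ ∷ σs) = 0th

  ∈-tails-tail : ∀ τs → σ ∷ σs ∈ tails τs → σs ∈ tails τs
  ∈-tails-tail []       (here ())
  ∈-tails-tail (τ ∷ τs) 0th       = there (∈-tails-refl τs)
  ∈-tails-tail (τ ∷ τs) (there e) = there (∈-tails-tail τs e)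

  ∈-tails-head : ∀ τs → σ ∷ σs ∈ tails τs → σ ∈ τs
  ∈-tails-head []       (here ())
  ∈-tails-head (τ ∷ τs) 0th       = 0th
  ∈-tails-head (τ ∷ τs) (there e) = there (∈-tails-head τs e)

  -- Comparisons of nominals contribute no form: `resolve` and the decided equalities treat them as
  -- literals.
  body : SF → List Form
  body (atS x φ)      = φ ∷ []
  body (cmpS x p c y) = []

  pathsOf : Form → List Path
  pathsOf (cmp α p c β) = α ∷ β ∷ []
  pathsOf _             = []

  module Fragment (χs : List SF) (b : ℕ) (bounded : ∀ {χ} → χ ∈ χs → boundS χ ≤ b) where

    forms : List Form
    forms = concatMap sub (concatMap body χs)

    paths : List Path
    paths = concatMap pathsOf forms

    suffixes : List (List Step)
    suffixes = concatMap (tails ∘ flat) paths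

    maxDepth : ℕ
    maxDepth = max 0 (map depth forms) ⊔ max 0 (map depthSs suffixes)

    forms-closed : φ ∈ forms → ψ ∈ sub φ → ψ ∈ forms
    forms-closed e e′ with find (∈-concatMap⁻ sub {xs = concatMap body χs} e)
    ... | θ , θ∈ , m = ∈-concatMap⁺ sub (lose θ∈ (sub-trans θ m e′))

    body∈forms : ∀ {x φ} → atS x φ ∈ χs → φ ∈ forms
    body∈forms e =
      ∈-concatMap⁺ sub {xs = concatMap body χs} (lose (∈-concatMap⁺ body (lose e (here refl))) 0th)

    forms-bound : φ ∈ forms → bound φ ≤ b
    forms-bound e with find (∈-concatMap⁻ sub {xs = concatMap body χs} e)
    ... | θ , θ∈ , m with find (∈-concatMap⁻ body {xs = χs} θ∈)
    ... | atS x .θ , χ∈ , 0th =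
      ℕ.≤-trans (sub-bound θ m) (ℕ.≤-trans (ℕ.m≤n⊔m (suc x) (bound θ)) (bounded χ∈))

    paths⁻ : α ∈ paths → (∀ {i} → snom i ∈ flat α → i < b) × (∀ {ψ} → stest ψ ∈ flat α → ψ ∈ forms)
    paths⁻ e with find (∈-concatMap⁻ pathsOf {xs = forms} e)
    ... | cmp α p c β , θ∈ , 0th =
      (λ m → ℕ.≤-trans (snom∈flat α m) (ℕ.≤-trans (ℕ.m≤m⊔n _ (boundP β)) (forms-bound θ∈))) ,
      (λ m → forms-closed θ∈ (there (∈-++⁺ˡ (test∈flat α m))))
    ... | cmp α p c β , θ∈ , 1st =
      (λ m → ℕ.≤-trans (snom∈flat β m) (ℕ.≤-trans (ℕ.m≤n⊔m (boundP α) _) (forms-bound θ∈))) ,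
      (λ m → forms-closed θ∈ (there (∈-++⁺ʳ (subP α) (test∈flat β m))))

    suffixes⁻ : σs ∈ suffixes → ∃[ α ] α ∈ paths × σs ∈ tails (flat α)
    suffixes⁻ e = find (∈-concatMap⁻ (tails ∘ flat) {xs = paths} e)

    -- The successor in `suc b` keeps the set of named points nonempty even for the empty sequent.
    closure : Closure nm nc (suc b) forms paths suffixes maxDepth
    closure = record
      { 0<K₀        = s≤s z≤n
      ; nom-closed  = λ e → ℕ.m≤n⇒m≤1+n (forms-bound e)
      ; ⇒-closed    = λ {φ} {ψ} e →
          forms-closed e (there (∈-++⁺ˡ {xs = sub φ} 0th)) , forms-closed e (there (∈-++⁺ʳ (sub φ) 0th))
      ; at-closed   = λ {i} {φ} e →
          ℕ.m≤n⇒m≤1+n (ℕ.≤-trans (ℕ.m≤m⊔n (suc i) (bound φ)) (forms-bound e)) , forms-closed e 1st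
      ; dia-closed  = λ e → forms-closed e 1st
      ; cmp-closed  = λ e → ∈-concatMap⁺ pathsOf (lose e 0th) , ∈-concatMap⁺ pathsOf (lose e 1st)
      ; flat-closed = λ {α} e → ∈-concatMap⁺ (tails ∘ flat) (lose e (∈-tails-refl (flat α)))
      ; tail-closed = λ e → let α , α∈ , m = suffixes⁻ e in
          ∈-concatMap⁺ (tails ∘ flat) (lose α∈ (∈-tails-tail (flat α) m))
      ; snom-closed = λ e → let α , α∈ , m = suffixes⁻ e in
          ℕ.m≤n⇒m≤1+n (proj₁ (paths⁻ α∈) (∈-tails-head (flat α) m))
      ; test-closed = λ e → let α , α∈ , m = suffixes⁻ e in proj₂ (paths⁻ α∈) (∈-tails-head (flat α) m)
      ; Φ-depth     = λ e → ℕ.≤-trans (All.lookup (xs≤max 0 (map depth forms)) (∈-map⁺ depth e)) (ℕ.m≤m⊔n _ _)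
      ; CP-depth    = λ e → ℕ.≤-trans (All.lookup (xs≤max 0 (map depthSs suffixes)) (∈-map⁺ depthSs e))
                                      (ℕ.m≤n⊔m (max 0 (map depth forms)) _)
      }

-- Derivations from closed tableaux, countermodels from open ones.

module Completeness (nm nc : ℕ) where
  open HX nm nc
  open Calculus nm nc
  open Tableau nm nc
  open Subforms nm nc

  module _ (Γ Δ : List SF) where

    root : Branch
    root = map T Γ ++ map F Δ

    T∈root : ∀ {χ} → χ ∈ Γ → T χ ∈ root
    T∈root e = ∈-++⁺ˡ (∈-map⁺ T e)

    F∈root : ∀ {χ} → χ ∈ Δ → F χ ∈ root
    F∈root e = ∈-++⁺ʳ (map T Γ) (∈-map⁺ F e)

    root-bounded : ∀ {χ} → χ ∈ Γ ++ Δ → boundS χ ≤ boundB root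
    root-bounded e = [ boundT ∘ T∈root , boundF ∘ F∈root ]′ (∈-++⁻ Γ e)

    lefts⊆ : lefts root ⊆ Γ
    lefts⊆ e with ∈-++⁻ (map T Γ) (∈-lefts⁻ e)
    ... | inj₁ m with _ , m′ , refl ← ∈-map⁻ T m = m′
    ... | inj₂ m with _ , _ , () ← ∈-map⁻ F m

    rights⊆ : rights root ⊆ Δ
    rights⊆ e with ∈-++⁻ (map T Γ) (∈-rights⁻ e)
    ... | inj₁ m with _ , _ , () ← ∈-map⁻ T m
    ... | inj₂ m with _ , m′ , refl ← ∈-map⁻ F m = m′

    open Fragment (Γ ++ Δ) (boundB root) root-bounded
    open Closure closure using (CP-depth)

    K₀ : ℕ
    K₀ = suc (boundB root)

    open Saturation nm nc K₀ forms suffixes maxDepth CP-depth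

    record Open (B : Branch) : Set where
      field
        resolved  : ∀ {u} → u ∈ root → Resolved u B
        saturated : Saturated B
        consistent : Checks.Hintikka nm nc K₀ forms paths suffixes (Saturated.K saturated) B

    tableau : Tab Open root
    tableau =
      forList Resolved Resolved-mono root (λ u e i → resolve u (i e)) >>= λ _ rs →
      saturate >>= λ i S →
      [ shut , (λ H → leaf (record
        { resolved = λ {u} e → Resolved-mono u i (rs u e) ; saturated = S ; consistent = H }))
      ]′ (Checks.hintikka nm nc K₀ forms _ _ _ _)

    module _ {B : Branch} (root⊆B : root ⊆ B) (o : Open B) where
      open Open o
      open Countermodel nm nc K₀ forms paths suffixes maxDepth closure B saturated consistent

      inScope : ∀ χ → χ ∈ Γ ++ Δ → InScope χ
      inScope (atS x φ) e =
        ℕ.m≤n⇒m≤1+n (ℕ.≤-trans (ℕ.m≤m⊔n (suc x) (bound φ)) (root-bounded e)) ,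
        body∈forms e
      inScope (cmpS x p c y) e =
        ℕ.m≤n⇒m≤1+n (ℕ.≤-trans (ℕ.m≤m⊔n (suc x) (suc y)) (root-bounded e)) ,
        ℕ.m≤n⇒m≤1+n (ℕ.≤-trans (ℕ.m≤n⊔m (suc x) (suc y)) (root-bounded e))

      refutation : ¬ Valid Γ Δ
      refutation valid =
        let χ , e , h = find (valid model (All.tabulate λ {χ} e →
              holds χ (inScope χ (∈-++⁺ˡ e)) (resolved (T∈root e)) (root⊆B (T∈root e))))
        in fails χ (inScope χ (∈-++⁺ʳ Γ e)) (resolved (F∈root e)) (root⊆B (F∈root e)) h

    completeness : Valid Γ Δ → Γ ⊢G Δ
    completeness valid =
      [ weaken-⊢ lefts⊆ rights⊆ ∘ derivation
      , (λ (_ , i , o) → ⊥-elim (refutation i o valid))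
      ]′ (run tableau)

theorem3 : (nm nc : ℕ) (Γ Δ : List (HX.SF nm nc)) →
    HX.Valid nm nc Γ Δ → HX._⊢G_ nm nc Γ Δ
theorem3 = Completeness.completeness
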